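{- Let $M$ be a lattice path matroid without loops or coloops that is not (isomorphic to) a direct sum of trivial snakes. Then \[ T(M;2,0)\cdot T(M;0,2)\geq \frac{4}{3}\cdot T(M;1,1)^2 . \]
   Context: For a matroid $M$ on ground set $E$ with rank function $r$, the Tutte polynomial is $T(M;x,y)=\sum_{A\subseteq E}(x-1)^{r(E)-r(A)}(y-1)^{|A|-r(A)}$. Lattice path matroids: a lattice path is a sequence of unit steps $N=(0,1)$ and $E=(1,0)$ starting at the origin. A lattice path with $m+r$ steps ending at $(m,r)$ is encoded by the set $\{s_1<\dots<s_r\}\subseteq\{1,\dots,m+r\}$ of positions of its North steps. Given two such paths $P=\{s_1<\dots<s_r\}$ and $Q=\{t_1<\dots<t_r\}$ ending at $(m,r)$ with $P$ never going above $Q$ (equivalently $t_i\le s_i$ for all $i$), the lattice path matroid $M[P,Q]$ is the transversal matroid on $\{1,\dots,m+r\}$ with presentation $(A_1,\dots,A_r)$, $A_i=\{t_i,t_i+1,\dots,s_i\}$; its bases are the sets $\{x_1,\dots,x_r\}$ of $r$ distinct elements with $x_i\in A_i$. Equivalently, an $r$-subset $B$ is a basis iff the lattice path whose North steps are at the positions in $B$ stays in the closed region bounded by $P$ and $Q$ (the diagram of $M[P,Q]$). A lattice path matroid (LPM) is a matroid isomorphic to some $M[P,Q]$. The trivial snake is the LPM $M[P,Q]$ with $P=EN$, $Q=NE$ (diagram a single unit square); it is the matroid on two elements that are parallel, i.e. $U_{1,2}$. -}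

module Defs where

open import Data.Nat as ℕ using (ℕ; zero; suc; _+_; _∸_; _⊔_; _≤_; _≤ᵇ_; _≡ᵇ_)
open import Data.Bool using (Bool; true; false; _∧_; _xor_; if_then_else_)
open import Data.Vec using (Vec; []; _∷_; lookup; tabulate)
open import Data.Fin using (Fin; zero; suc; _↑ˡ_; _↑ʳ_)
open import Data.Fin.Subset using (Subset; _∩_; ∣_∣)
open import Data.List using (List; []; _∷_; map; _++_; foldr; upTo; allFin)
open import Data.Integer as ℤ using (ℤ; +_; _-_; _*_; _^_)
open import Data.Product using (Σ; ∃; _×_; _,_)
open import Data.Empty using (⊥)
open import Function.Bundles using (_↔_; Inverse)
open import Relation.Binary.PropositionalEquality using (_≡_)

-- Finite matroids on ground set Fin n, given by their set of bases
-- (as a decidable predicate on subsets).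

allL : ∀ {A : Set} → (A → Bool) → List A → Bool
allL p xs = foldr (λ a b → p a ∧ b) true xs

BasisSystem : ℕ → Set
BasisSystem n = Subset n → Bool

allSubsets : (n : ℕ) → List (Subset n)
allSubsets zero    = [] ∷ []
allSubsets (suc n) = map (true ∷_) (allSubsets n) ++ map (false ∷_) (allSubsets n)

rank : ∀ {n} → BasisSystem n → Subset n → ℕ
rank {n} M A = foldr _⊔_ 0 (map (λ B → if M B then ∣ A ∩ B ∣ else 0) (allSubsets n))

fullSet : ∀ n → Subset n
fullSet n = tabulate (λ _ → true)

tutte : ∀ {n} → BasisSystem n → ℤ → ℤ → ℤ
tutte {n} M x y =
  foldr ℤ._+_ (+ 0)
    (map (λ A → ((x - + 1) ^ (rank M (fullSet n) ∸ rank M A))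
              * ((y - + 1) ^ (∣ A ∣ ∸ rank M A)))
         (allSubsets n))

Loopless : ∀ {n} → BasisSystem n → Set
Loopless {n} M = (e : Fin n) → ∃ λ B → M B ≡ true × lookup B e ≡ true

ColooplessM : ∀ {n} → BasisSystem n → Set
ColooplessM {n} M = (e : Fin n) → ∃ λ B → M B ≡ true × lookup B e ≡ false

image : ∀ {n n'} → (Fin n ↔ Fin n') → Subset n → Subset n'
image σ B = tabulate (λ i → lookup B (Inverse.from σ i))

_≅_ : ∀ {n n'} → BasisSystem n → BasisSystem n' → Set
_≅_ {n} {n'} M N = Σ (Fin n ↔ Fin n') λ σ → (B : Subset n) → M B ≡ N (image σ B)

-- Lattice path matroids.
-- A lattice path with m+r steps ending at (m,r) is encoded by the subset of
-- {0,…,m+r-1} (positions 1..m+r shifted by one) of its North steps.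

pre : ∀ {n} → Subset n → ℕ → ℕ
pre []      k       = 0
pre (b ∷ s) zero    = 0
pre (b ∷ s) (suc k) = (if b then 1 else 0) + pre s k

record LPMPres : Set where
  field
    m r    : ℕ
    P Q    : Subset (m + r)
    P-card : ∣ P ∣ ≡ r
    Q-card : ∣ Q ∣ ≡ r
    P≤Q    : (k : ℕ) → pre P k ≤ pre Q k

lpm : (L : LPMPres) → BasisSystem (LPMPres.m L + LPMPres.r L)
lpm L B =
  (∣ B ∣ ≡ᵇ r) ∧
  allL (λ k → (pre P k ≤ᵇ pre B k) ∧ (pre B k ≤ᵇ pre Q k)) (upTo (suc (m + r)))
  where open LPMPres L

IsLPM : ∀ {n} → BasisSystem n → Set
IsLPM M = Σ LPMPres λ L → M ≅ lpm L

-- The direct sum of k trivial snakes U_{1,2} ⊕ … ⊕ U_{1,2}, on ground set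
-- Fin (k + k), where element j (j < k) is parallel to element k + j:
-- bases are the sets containing exactly one element of each pair.
trivialSnakeSum : (k : ℕ) → BasisSystem (k + k)
trivialSnakeSum k B =
  allL (λ j → lookup B (j ↑ˡ k) xor lookup B (k ↑ʳ j)) (allFin k)

IsoToTrivialSnakeSum : ∀ {n} → BasisSystem n → Set
IsoToTrivialSnakeSum M = ∃ λ k → M ≅ trivialSnakeSum k

{-# OPTIONS --safe #-}

-- Delete and contract the first step: the Tutte polynomial of a lattice path matroid is
-- then computed by a transfer process whose state is a point between P and Q, so that at
-- each time there is one value per point of the current antidiagonal.  By induction on
-- the time, the values at any two adjacent points are a sum of pairs coming from snakes
-- (diagrams of width one), because every step adds two neighbouring pairs, except at
-- the boundary, where it extends a snake by an east or by a north step.  For snakes the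
-- bound T(2,0) T(0,2) ≥ 4/3 T(1,1)² follows from finitely many quadratic inequalities
-- that are stable under both extensions, and by the Cauchy–Schwarz inequality all these
-- bounds are stable under sums.  Meeting points of P and Q split the matroid into a direct
-- sum, for which the bounds multiply, and a trivial snake contributes the factor 1.
module Submission where

open import Defs
import Data.Integer.Properties as ℤ
import Data.Integer.Tactic.RingSolver as ℤ
open import Data.Bool using (Bool; true; false; if_then_else_; _∧_; _xor_)
open import Data.Bool.Properties using (∧-conicalˡ; ∧-conicalʳ; T-≡; ⇔→≡)
open import Data.Fin using (Fin; zero; suc; join)
open import Data.Fin.Properties using (+↔⊎)
open import Data.Fin.Subset using (Subset; _∩_; ∣_∣)
open import Data.Fin.Subset.Properties using (∣p∩q∣≤∣p∣; ∣p∩q∣≤∣q∣)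
open import Data.Integer as ℤ using (ℤ; +_)
open import Data.List as List using (List; []; _∷_; map; foldr; _++_; upTo)
open import Data.List.Properties using (map-∘; map-cong)
open import Data.List.Membership.Propositional using (_∈_)
open import Data.List.Membership.Propositional.Properties using (∈-map⁺; ∈-map⁻; ∈-++⁺ˡ; ∈-++⁺ʳ; ∈-upTo⁺)
open import Data.List.Membership.Propositional.Properties.WithK using (unique∧set⇒bag)
open import Data.List.Relation.Binary.BagAndSetEquality using (∼bag⇒↭)
open import Data.List.Relation.Binary.Permutation.Propositional as ↭ using (_↭_)
open import Data.List.Relation.Unary.All using ([])
open import Data.List.Relation.Unary.AllPairs using ([]; _∷_)
open import Data.List.Relation.Unary.Any using (here; there)
open import Data.List.Relation.Unary.Unique.Propositional using (Unique)
open import Data.List.Relation.Unary.Unique.Propositional.Properties using (map⁺; ++⁺)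
open import Data.Product using (∃; ∃₂; _×_; _,_; proj₁; proj₂)
open import Data.Sum as Sum using (_⊎_; inj₁; inj₂)
open import Data.Vec using ([]; _∷_; lookup)
open import Data.Vec.Properties using (lookup∘tabulate; tabulate∘lookup; tabulate-cong; lookup-zipWith; ∷-injectiveʳ)
open import Function using (_∘_)
open import Function.Bundles using (_↔_; Inverse; Equivalence; mk⇔; mk↔ₛ′)
open import Function.Construct.Composition using (_↔-∘_)
open import Function.Construct.Symmetry using (↔-sym)
open import Relation.Nullary using (¬_; contradiction; yes; no)
open import Relation.Binary.PropositionalEquality

module LatticePaths where

  open import Data.Nat using (ℕ; zero; suc; _+_; _*_; _∸_; _⊔_; _≤_; z≤n; s≤s; s≤s⁻¹; _≤ᵇ_; _≡ᵇ_)
  open import Data.Nat.Properties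
  open import Data.Nat.Tactic.RingSolver using (solve-∀)
  open import Algebra.Properties.CommutativeMonoid.Sum +-0-commutativeMonoid using (sum; sum-permute; sum-cong-≗)

  -- The cone of snakes

  square-cancel-≤ : ∀ m n → m * m ≤ n * n → m ≤ n
  square-cancel-≤ m n m²≤n² = ≮⇒≥ λ n<m → <⇒≱ (*-mono-< n<m n<m) m²≤n²

  am-gm : ∀ m n → 4 * (m * n) ≤ (m + n) * (m + n)
  am-gm m n with ≤-total m n
  ... | inj₁ m≤n with k , refl ← m≤n⇒∃[o]m+o≡n m≤n =
    subst (4 * (m * (m + k)) ≤_) (eq m k) (m≤m+n _ (k * k))
    where
    eq : ∀ m k → 4 * (m * (m + k)) + k * k ≡ (m + (m + k)) * (m + (m + k))
    eq = solve-∀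
  ... | inj₂ n≤m with k , refl ← m≤n⇒∃[o]m+o≡n n≤m =
    subst (4 * ((n + k) * n) ≤_) (eq n k) (m≤m+n _ (k * k))
    where
    eq : ∀ n k → 4 * ((n + k) * n) + k * k ≡ ((n + k) + n) * ((n + k) + n)
    eq = solve-∀

  -- Up to the square roots of `p` and `q`, `a` is at most the geometric mean of `b` and `c`, and
  -- geometric means are superadditive. The only new term is `2 * (p * (a * a′))`; it is compared
  -- after squaring, which avoids roots, with AM-GM applied to the two mixed products.
  cauchy-schwarz : ∀ p q {a b c a′ b′ c′} →
    p * (a * a) ≤ q * (b * c) → p * (a′ * a′) ≤ q * (b′ * c′) →
    p * ((a + a′) * (a + a′)) ≤ q * ((b + b′) * (c + c′))
  cauchy-schwarz p q {a} {b} {c} {a′} {b′} {c′} h h′ = begin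
    p * ((a + a′) * (a + a′))                                ≡⟨ expandˡ p a a′ ⟩
    p * (a * a) + p * (a′ * a′) + 2 * (p * (a * a′))         ≤⟨ +-mono-≤ (+-mono-≤ h h′) cross ⟩
    q * (b * c) + q * (b′ * c′) + (q * (b * c′) + q * (b′ * c)) ≡⟨ expandʳ q b c b′ c′ ⟩
    q * ((b + b′) * (c + c′))                                ∎
    where
    open ≤-Reasoning
    expandˡ : ∀ p a a′ → p * ((a + a′) * (a + a′)) ≡ p * (a * a) + p * (a′ * a′) + 2 * (p * (a * a′))
    expandˡ = solve-∀
    expandʳ : ∀ q b c b′ c′ →
      q * (b * c) + q * (b′ * c′) + (q * (b * c′) + q * (b′ * c)) ≡ q * ((b + b′) * (c + c′))
    expandʳ = solve-∀
    regroupˡ : ∀ p a a′ → 2 * (p * (a * a′)) * (2 * (p * (a * a′))) ≡ 4 * (p * (a * a) * (p * (a′ * a′)))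
    regroupˡ = solve-∀
    regroupʳ : ∀ q b c b′ c′ → 4 * (q * (b * c) * (q * (b′ * c′))) ≡ 4 * (q * (b * c′) * (q * (b′ * c)))
    regroupʳ = solve-∀
    cross : 2 * (p * (a * a′)) ≤ q * (b * c′) + q * (b′ * c)
    cross = square-cancel-≤ _ _ (begin
      2 * (p * (a * a′)) * (2 * (p * (a * a′))) ≡⟨ regroupˡ p a a′ ⟩
      4 * (p * (a * a) * (p * (a′ * a′)))       ≤⟨ *-monoʳ-≤ 4 (*-mono-≤ h h′) ⟩
      4 * (q * (b * c) * (q * (b′ * c′)))       ≡⟨ regroupʳ q b c b′ c′ ⟩
      4 * (q * (b * c′) * (q * (b′ * c)))       ≤⟨ am-gm (q * (b * c′)) (q * (b′ * c)) ⟩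
      _                                         ∎)

  -- A pair of adjacent states in a snake that ends with an east run has a-values
  -- (A , A + D), b-values (0 , B) and c-values (C₀ , C₁).  `total` is the desired
  -- bound for the pair, and it is what survives one more step in the same
  -- direction thanks to `running` and a change of direction thanks to `turning`.
  record Cone : Set where
    field
      A D B C₀ C₁ : ℕ
      total   : 4 * ((2 * A + D) * (2 * A + D)) ≤ 3 * (B * (C₀ + C₁))
      turning : 4 * ((3 * A + 2 * D) * (3 * A + 2 * D)) ≤ 9 * (B * (C₀ + C₁))
      running : 2 * ((4 * A + D) * (4 * A + D)) ≤ 9 * (B * C₀)

  open Cone

  𝟘 : Cone
  𝟘 = record { A = 0 ; D = 0 ; B = 0 ; C₀ = 0 ; C₁ = 0 ; total = z≤n ; turning = z≤n ; running = z≤n }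

  infixl 6 _⊕_
  _⊕_ : Cone → Cone → Cone
  k ⊕ l = record
    { A = A k + A l ; D = D k + D l ; B = B k + B l ; C₀ = C₀ k + C₀ l ; C₁ = C₁ k + C₁ l
    ; total = subst₂ (λ s t → 4 * (s * s) ≤ 3 * ((B k + B l) * t))
        (lin 2 (A k) (D k) (A l) (D l)) (interchange (C₀ k) (C₁ k) (C₀ l) (C₁ l))
        (cauchy-schwarz 4 3 {2 * A k + D k} {B k} (total k) (total l))
    ; turning = subst₂ (λ s t → 4 * (s * s) ≤ 9 * ((B k + B l) * t))
        (lin₂ (A k) (D k) (A l) (D l)) (interchange (C₀ k) (C₁ k) (C₀ l) (C₁ l))
        (cauchy-schwarz 4 9 {3 * A k + 2 * D k} {B k} (turning k) (turning l))
    ; running = subst (λ s → 2 * (s * s) ≤ 9 * ((B k + B l) * (C₀ k + C₀ l)))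
        (lin 4 (A k) (D k) (A l) (D l))
        (cauchy-schwarz 2 9 {4 * A k + D k} {B k} (running k) (running l)) }
    where
    lin : ∀ m a d a′ d′ → m * a + d + (m * a′ + d′) ≡ m * (a + a′) + (d + d′)
    lin = solve-∀
    lin₂ : ∀ a d a′ d′ → 3 * a + 2 * d + (3 * a′ + 2 * d′) ≡ 3 * (a + a′) + 2 * (d + d′)
    lin₂ = solve-∀
    interchange : ∀ a b c d → a + b + (c + d) ≡ a + c + (b + d)
    interchange = solve-∀

  -- The effect of `east` on an east run: the a-values become (A , 2A + D), the b-values stay (0 ,
  -- B), the c-values become (2C₀ , C₀ + C₁). Hence B times the new c-sum is the old product plus
  -- 2BC₀, and `running` bounds this increment.
  straight : Cone → Cone
  straight k = record
    { A = a ; D = a + d ; B = b ; C₀ = 2 * c₀ ; C₁ = c₀ + c₁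
    -- The factor 3 clears the denominators of `running` and `total`; the two old left sides then
    -- exceed the new one by exactly the square 4(a + d)².
    ; total = *-cancelˡ-≤ 3 (begin
        3 * (4 * ((2 * a + (a + d)) * (2 * a + (a + d))))
          ≤⟨ m≤m+n _ (4 * ((a + d) * (a + d))) ⟩
        3 * (4 * ((2 * a + (a + d)) * (2 * a + (a + d)))) + 4 * ((a + d) * (a + d))
          ≡⟨ total-lhs a d ⟩
        2 * (2 * ((4 * a + d) * (4 * a + d))) + 3 * (4 * ((2 * a + d) * (2 * a + d)))
          ≤⟨ +-mono-≤ (*-monoʳ-≤ 2 (running k)) (*-monoʳ-≤ 3 (total k)) ⟩
        2 * (9 * (b * c₀)) + 3 * (3 * (b * (c₀ + c₁)))
          ≡⟨ total-rhs b c₀ c₁ ⟩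
        3 * (3 * (b * (2 * c₀ + (c₀ + c₁)))) ∎)
    ; turning = begin
        4 * ((3 * a + 2 * (a + d)) * (3 * a + 2 * (a + d)))
          ≤⟨ m≤m+n _ (4 * (d * d)) ⟩
        4 * ((3 * a + 2 * (a + d)) * (3 * a + 2 * (a + d))) + 4 * (d * d)
          ≡⟨ turning-lhs a d ⟩
        2 * (2 * ((4 * a + d) * (4 * a + d))) + 4 * ((3 * a + 2 * d) * (3 * a + 2 * d))
          ≤⟨ +-mono-≤ (*-monoʳ-≤ 2 (running k)) (turning k) ⟩
        2 * (9 * (b * c₀)) + 9 * (b * (c₀ + c₁))
          ≡⟨ turning-rhs b c₀ c₁ ⟩
        9 * (b * (2 * c₀ + (c₀ + c₁))) ∎
    -- The right side doubles, and (5a + d)² ≤ 2(4a + d)² holds coefficientwise.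
    ; running = begin
        2 * ((4 * a + (a + d)) * (4 * a + (a + d)))
          ≤⟨ m≤m+n _ (2 * (7 * (a * a) + 6 * (a * d) + d * d)) ⟩
        2 * ((4 * a + (a + d)) * (4 * a + (a + d))) + 2 * (7 * (a * a) + 6 * (a * d) + d * d)
          ≡⟨ running-lhs a d ⟩
        2 * (2 * ((4 * a + d) * (4 * a + d)))
          ≤⟨ *-monoʳ-≤ 2 (running k) ⟩
        2 * (9 * (b * c₀))
          ≡⟨ running-rhs b c₀ ⟩
        9 * (b * (2 * c₀)) ∎ }
    where
    open ≤-Reasoning
    a = A k ; d = D k ; b = B k ; c₀ = C₀ k ; c₁ = C₁ k
    total-lhs : ∀ a d →
      3 * (4 * ((2 * a + (a + d)) * (2 * a + (a + d)))) + 4 * ((a + d) * (a + d)) ≡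
      2 * (2 * ((4 * a + d) * (4 * a + d))) + 3 * (4 * ((2 * a + d) * (2 * a + d)))
    total-lhs = solve-∀
    total-rhs : ∀ b c₀ c₁ →
      2 * (9 * (b * c₀)) + 3 * (3 * (b * (c₀ + c₁))) ≡ 3 * (3 * (b * (2 * c₀ + (c₀ + c₁))))
    total-rhs = solve-∀
    turning-lhs : ∀ a d →
      4 * ((3 * a + 2 * (a + d)) * (3 * a + 2 * (a + d))) + 4 * (d * d) ≡
      2 * (2 * ((4 * a + d) * (4 * a + d))) + 4 * ((3 * a + 2 * d) * (3 * a + 2 * d))
    turning-lhs = solve-∀
    turning-rhs : ∀ b c₀ c₁ →
      2 * (9 * (b * c₀)) + 9 * (b * (c₀ + c₁)) ≡ 9 * (b * (2 * c₀ + (c₀ + c₁)))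
    turning-rhs = solve-∀
    running-lhs : ∀ a d →
      2 * ((4 * a + (a + d)) * (4 * a + (a + d))) + 2 * (7 * (a * a) + 6 * (a * d) + d * d) ≡
      2 * (2 * ((4 * a + d) * (4 * a + d)))
    running-lhs = solve-∀
    running-rhs : ∀ b c₀ → 2 * (9 * (b * c₀)) ≡ 9 * (b * (2 * c₀))
    running-rhs = solve-∀

  -- The effect of `east` on a north run, whose pair is (A + D , A), (C₁ , C₀), (B , 0). The result
  -- is again the pair of an east run, now with c-sum 3B, so that the new `total` is the old
  -- `turning`.
  turn : Cone → Cone
  turn k = record
    { A = a + d ; D = a ; B = c₀ + c₁ ; C₀ = 2 * b ; C₁ = b
    ; total = begin
        4 * ((2 * (a + d) + a) * (2 * (a + d) + a))  ≡⟨ total-lhs a d ⟩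
        4 * ((3 * a + 2 * d) * (3 * a + 2 * d))      ≤⟨ turning k ⟩
        9 * (b * (c₀ + c₁))                          ≡⟨ total-rhs b (c₀ + c₁) ⟩
        3 * ((c₀ + c₁) * (2 * b + b))                ∎
    -- Adding one more a turns 5a + 3d into three times 2a + d, which `total` controls.
    ; turning = begin
        4 * ((3 * (a + d) + 2 * a) * (3 * (a + d) + 2 * a))
          ≤⟨ *-monoʳ-≤ 4 (*-mono-≤ (m≤m+n (3 * (a + d) + 2 * a) a) (m≤m+n (3 * (a + d) + 2 * a) a)) ⟩
        4 * ((3 * (a + d) + 2 * a + a) * (3 * (a + d) + 2 * a + a))
          ≡⟨ turning-lhs a d ⟩
        9 * (4 * ((2 * a + d) * (2 * a + d)))
          ≤⟨ *-monoʳ-≤ 9 (total k) ⟩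
        9 * (3 * (b * (c₀ + c₁)))
          ≡⟨ turning-rhs b (c₀ + c₁) ⟩
        9 * ((c₀ + c₁) * (2 * b + b)) ∎
    -- Likewise 5a + 4d is at most twice 3a + 2d, which `turning` controls.
    ; running = begin
        2 * ((4 * (a + d) + a) * (4 * (a + d) + a))
          ≤⟨ *-monoʳ-≤ 2 (*-mono-≤ (m≤m+n (4 * (a + d) + a) a) (m≤m+n (4 * (a + d) + a) a)) ⟩
        2 * ((4 * (a + d) + a + a) * (4 * (a + d) + a + a))
          ≡⟨ running-lhs a d ⟩
        2 * (4 * ((3 * a + 2 * d) * (3 * a + 2 * d)))
          ≤⟨ *-monoʳ-≤ 2 (turning k) ⟩
        2 * (9 * (b * (c₀ + c₁)))
          ≡⟨ running-rhs b (c₀ + c₁) ⟩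
        9 * ((c₀ + c₁) * (2 * b)) ∎ }
    where
    open ≤-Reasoning
    a = A k ; d = D k ; b = B k ; c₀ = C₀ k ; c₁ = C₁ k
    total-lhs : ∀ a d →
      4 * ((2 * (a + d) + a) * (2 * (a + d) + a)) ≡ 4 * ((3 * a + 2 * d) * (3 * a + 2 * d))
    total-lhs = solve-∀
    total-rhs : ∀ b c → 9 * (b * c) ≡ 3 * (c * (2 * b + b))
    total-rhs = solve-∀
    turning-lhs : ∀ a d →
      4 * ((3 * (a + d) + 2 * a + a) * (3 * (a + d) + 2 * a + a)) ≡
      9 * (4 * ((2 * a + d) * (2 * a + d)))
    turning-lhs = solve-∀
    turning-rhs : ∀ b c → 9 * (3 * (b * c)) ≡ 9 * (c * (2 * b + b))
    turning-rhs = solve-∀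
    running-lhs : ∀ a d →
      2 * ((4 * (a + d) + a + a) * (4 * (a + d) + a + a)) ≡
      2 * (4 * ((3 * a + 2 * d) * (3 * a + 2 * d)))
    running-lhs = solve-∀
    running-rhs : ∀ b c → 2 * (9 * (b * c)) ≡ 9 * (c * (2 * b))
    running-rhs = solve-∀

  -- The seed of all cones: a trivial snake's pair, next to a summand with values a, b, c, after one
  -- `east`. Here `total` is 36 times the hypothesis on both sides, so the constant 4/3 is sharp; a
  -- = b = c = 1 gives U₁,₃, with values 3, 2, 6. The other two bounds have slack.
  twoStep : ∀ a b c → a * a ≤ b * c → Cone
  twoStep a b c h = record
    { A = a ; D = a ; B = 2 * b ; C₀ = 4 * c ; C₁ = 2 * c
    ; total = subst₂ _≤_ (total-lhs a) (total-rhs b c) (*-monoʳ-≤ 36 h)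
    ; turning = subst₂ _≤_ (turning-lhs a) (turning-rhs b c)
        (*-mono-≤ (m≤m+n 100 8) h)
    ; running = subst₂ _≤_ (running-lhs a) (running-rhs b c)
        (*-mono-≤ (m≤m+n 50 22) h) }
    where
    total-lhs : ∀ a → 36 * (a * a) ≡ 4 * ((2 * a + a) * (2 * a + a))
    total-lhs = solve-∀
    total-rhs : ∀ b c → 36 * (b * c) ≡ 3 * (2 * b * (4 * c + 2 * c))
    total-rhs = solve-∀
    turning-lhs : ∀ a → 100 * (a * a) ≡ 4 * ((3 * a + 2 * a) * (3 * a + 2 * a))
    turning-lhs = solve-∀
    turning-rhs : ∀ b c → 108 * (b * c) ≡ 9 * (2 * b * (4 * c + 2 * c))
    turning-rhs = solve-∀
    running-lhs : ∀ a → 50 * (a * a) ≡ 2 * ((4 * a + a) * (4 * a + a))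
    running-lhs = solve-∀
    running-rhs : ∀ b c → 72 * (b * c) ≡ 9 * (2 * b * (4 * c))
    running-rhs = solve-∀

  -- Pairs of adjacent states

  -- The values of T(1,1), T(2,0), T(0,2) (letters a, b, c) at two adjacent states.
  record Pair : Set where
    constructor pair
    field
      a₀ a₁ b₀ b₁ c₀ c₁ : ℕ

  pair-≡ : ∀ {a₀ a₁ b₀ b₁ c₀ c₁ a₀′ a₁′ b₀′ b₁′ c₀′ c₁′} →
    a₀ ≡ a₀′ → a₁ ≡ a₁′ → b₀ ≡ b₀′ → b₁ ≡ b₁′ → c₀ ≡ c₀′ → c₁ ≡ c₁′ →
    pair a₀ a₁ b₀ b₁ c₀ c₁ ≡ pair a₀′ a₁′ b₀′ b₁′ c₀′ c₁′
  pair-≡ refl refl refl refl refl refl = refl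

  infixl 6 _⊞_
  _⊞_ : Pair → Pair → Pair
  pair a₀ a₁ b₀ b₁ c₀ c₁ ⊞ pair a₀′ a₁′ b₀′ b₁′ c₀′ c₁′ =
    pair (a₀ + a₀′) (a₁ + a₁′) (b₀ + b₀′) (b₁ + b₁′) (c₀ + c₀′) (c₁ + c₁′)

  -- Index 0 is the upper state. On Q, when Q goes east, the step is a loop and gives the factor y;
  -- on P, when P goes north, it is a coloop and gives x. The factors 1, 0, 2 stand unreduced so
  -- that these pairs agree with `T` by computation.
  east north : Pair → Pair
  east (pair a₀ a₁ b₀ b₁ c₀ c₁) =
    pair (1 * a₀) (a₀ + a₁) (0 * b₀) (b₀ + b₁) (2 * c₀) (c₀ + c₁)
  north (pair a₀ a₁ b₀ b₁ c₀ c₁) =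
    pair (a₀ + a₁) (1 * a₁) (b₀ + b₁) (2 * b₁) (c₀ + c₁) (0 * c₁)

  -- The two states one step before a meeting point: the upper one must go east (factor y), the
  -- lower one north (factor x).
  initial : ℕ → ℕ → ℕ → Pair
  initial a b c = pair (1 * a) (1 * a) (0 * b) (2 * b) (2 * c) (0 * c)

  -- Matroid duality turns the pair of an east run into that of a north run by
  -- exchanging b with c and the two states.
  embed : Cone → Cone → Pair
  embed e n = pair (A e + (A n + D n)) ((A e + D e) + A n) (C₁ n) (B e + C₀ n) (C₀ e + B n) (C₁ e)

  Snakelike : Pair → Set
  Snakelike p = ∃₂ λ e n → p ≡ embed e n

  snakelike-⊞ : ∀ {p q} → Snakelike p → Snakelike q → Snakelike (p ⊞ q)
  snakelike-⊞ (e , n , refl) (e′ , n′ , refl) = e ⊕ e′ , n ⊕ n′ ,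
    pair-≡ (outer (A e) (A n) (D n) (A e′) (A n′) (D n′))
           (inner (A e) (D e) (A n) (A e′) (D e′) (A n′))
           refl
           (swap (B e) (C₀ n) (B e′) (C₀ n′))
           (swap (C₀ e) (B n) (C₀ e′) (B n′))
           refl
    where
    outer : ∀ x y z x′ y′ z′ → x + (y + z) + (x′ + (y′ + z′)) ≡ x + x′ + ((y + y′) + (z + z′))
    outer = solve-∀
    inner : ∀ x y z x′ y′ z′ → x + y + z + (x′ + y′ + z′) ≡ x + x′ + (y + y′) + (z + z′)
    inner = solve-∀
    swap : ∀ x y x′ y′ → x + y + (x′ + y′) ≡ x + x′ + (y + y′)
    swap = solve-∀

  -- The east run goes straight on and the north run turns; both end as east runs, so the north part
  -- becomes `𝟘`.
  snakelike-east : ∀ {p} → Snakelike p → Snakelike (east p)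
  snakelike-east (e , n , refl) = straight e ⊕ turn n , 𝟘 ,
    pair-≡ refl (a₁-eq (A e) (A n) (D n) (D e)) refl (b₁-eq (C₁ n) (B e) (C₀ n))
           (c₀-eq (C₀ e) (B n)) (c₁-eq (C₀ e) (B n) (C₁ e))
    where
    a₁-eq : ∀ a a′ d′ d → a + (a′ + d′) + (a + d + a′) ≡ a + (a′ + d′) + (a + d + a′) + 0
    a₁-eq = solve-∀
    b₁-eq : ∀ x y z → x + (y + z) ≡ y + (z + x) + 0
    b₁-eq = solve-∀
    c₀-eq : ∀ x y → 2 * (x + y) ≡ 2 * x + 2 * y + 0
    c₀-eq = solve-∀
    c₁-eq : ∀ x y z → x + y + z ≡ x + z + y
    c₁-eq = solve-∀

  snakelike-north : ∀ {p} → Snakelike p → Snakelike (north p)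
  snakelike-north (e , n , refl) = 𝟘 , straight n ⊕ turn e ,
    pair-≡ (a₀-eq (A e) (A n) (D n) (D e)) (a₁-eq (A e) (D e) (A n)) (b₀-eq (C₁ n) (B e) (C₀ n))
           (b₁-eq (B e) (C₀ n)) (c₀-eq (C₀ e) (B n) (C₁ e)) refl
    where
    a₀-eq : ∀ a a′ d′ d → a + (a′ + d′) + (a + d + a′) ≡ a′ + (a + d) + (a′ + d′ + a)
    a₀-eq = solve-∀
    a₁-eq : ∀ a d a′ → 1 * (a + d + a′) ≡ a′ + (a + d)
    a₁-eq = solve-∀
    b₀-eq : ∀ x y z → x + (y + z) ≡ z + x + y
    b₀-eq = solve-∀
    b₁-eq : ∀ x y → 2 * (x + y) ≡ 2 * y + 2 * x
    b₁-eq = solve-∀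
    c₀-eq : ∀ x y z → x + y + z ≡ y + (x + z)
    c₀-eq = solve-∀

  snakelike-east-initial : ∀ a b c → a * a ≤ b * c → Snakelike (east (initial a b c))
  snakelike-east-initial a b c h = twoStep a b c h , 𝟘 ,
    pair-≡ (a₀-eq a) (a₁-eq a) refl (b₁-eq b) (c₀-eq c) (c₁-eq c)
    where
    a₀-eq : ∀ a → 1 * (1 * a) ≡ a + 0
    a₀-eq = solve-∀
    a₁-eq : ∀ a → 1 * a + 1 * a ≡ a + a + 0
    a₁-eq = solve-∀
    b₁-eq : ∀ b → 0 * b + 2 * b ≡ 2 * b + 0
    b₁-eq = solve-∀
    c₀-eq : ∀ c → 2 * (2 * c) ≡ 4 * c + 0
    c₀-eq = solve-∀
    c₁-eq : ∀ c → 2 * c + 0 * c ≡ 2 * c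
    c₁-eq = solve-∀

  snakelike-north-initial : ∀ a b c → a * a ≤ b * c → Snakelike (north (initial a b c))
  snakelike-north-initial a b c h = 𝟘 , twoStep a c b (subst (a * a ≤_) (*-comm b c) h) ,
    pair-≡ (a₀-eq a) (a₁-eq a) refl (b₁-eq b) (c₀-eq c) refl
    where
    a₀-eq : ∀ a → 1 * a + 1 * a ≡ a + a
    a₀-eq = solve-∀
    a₁-eq : ∀ a → 1 * (1 * a) ≡ a
    a₁-eq = solve-∀
    b₁-eq : ∀ b → 2 * (2 * b) ≡ 4 * b
    b₁-eq = solve-∀
    c₀-eq : ∀ c → 2 * c + 0 * c ≡ 2 * c
    c₀-eq = solve-∀

  -- The sums over both states are the values once P and Q meet. The two `total` bounds add by
  -- Cauchy-Schwarz, after b and c are exchanged for the north run.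
  snakelike⇒4/3 : ∀ {a₀ a₁ b₀ b₁ c₀ c₁} → Snakelike (pair a₀ a₁ b₀ b₁ c₀ c₁) →
    4 * ((a₀ + a₁) * (a₀ + a₁)) ≤ 3 * ((b₀ + b₁) * (c₀ + c₁))
  snakelike⇒4/3 (e , n , refl) =
    subst₂ (λ s t → 4 * (s * s) ≤ 3 * t)
      (a-eq (A e) (D e) (A n) (D n)) (bc-eq (B e) (C₀ e) (C₁ e) (B n) (C₀ n) (C₁ n))
      (cauchy-schwarz 4 3 {2 * A e + D e} {B e} {C₀ e + C₁ e} {b′ = C₀ n + C₁ n} (total e)
        (subst (λ t → 4 * ((2 * A n + D n) * (2 * A n + D n)) ≤ 3 * t) (*-comm (B n) (C₀ n + C₁ n)) (total n)))
    where
    a-eq : ∀ a d a′ d′ → 2 * a + d + (2 * a′ + d′) ≡ a + (a′ + d′) + (a + d + a′)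
    a-eq = solve-∀
    bc-eq : ∀ b c₀ c₁ b′ c₀′ c₁′ →
      (b + (c₀′ + c₁′)) * ((c₀ + c₁) + b′) ≡ (c₁′ + (b + c₀′)) * (c₀ + b′ + c₁)
    bc-eq = solve-∀

  -- Regions between two paths

  -- within P Q v u B: the path with north steps B that starts v below Q and u above P
  -- stays between P and Q and ends where they both end.
  within : ∀ {n} → Subset n → Subset n → ℕ → ℕ → BasisSystem n
  within []          []          zero    zero    []          = true
  within []          []          _       _       []          = false
  within (false ∷ P) (false ∷ Q) v       u       (false ∷ B) = within P Q v u B
  within (false ∷ P) (false ∷ Q) zero    u       (true ∷ B)  = false
  within (false ∷ P) (false ∷ Q) (suc v) u       (true ∷ B)  = within P Q v (suc u) B
  within (false ∷ P) (true ∷ Q)  v       u       (false ∷ B) = within P Q (suc v) u B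
  within (false ∷ P) (true ∷ Q)  v       u       (true ∷ B)  = within P Q v (suc u) B
  within (true ∷ P)  (false ∷ Q) v       zero    (false ∷ B) = false
  within (true ∷ P)  (false ∷ Q) v       (suc u) (false ∷ B) = within P Q v u B
  within (true ∷ P)  (false ∷ Q) zero    u       (true ∷ B)  = false
  within (true ∷ P)  (false ∷ Q) (suc v) u       (true ∷ B)  = within P Q v u B
  within (true ∷ P)  (true ∷ Q)  v       u       (true ∷ B)  = within P Q v u B
  within (true ∷ P)  (true ∷ Q)  v       zero    (false ∷ B) = false
  within (true ∷ P)  (true ∷ Q)  v       (suc u) (false ∷ B) = within P Q (suc v) u B

  -- The value at (x , y) of the Tutte polynomial of within P Q v u, by deletion and
  -- contraction of the first step; the values at the impossible states
  -- (v + u different from the distance of P and Q) are junk.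
  T : ∀ {n} → ℕ → ℕ → Subset n → Subset n → ℕ → ℕ → ℕ
  T x y []          []          v       u       = 1
  T x y (false ∷ P) (false ∷ Q) zero    u       = y * T x y P Q zero u
  T x y (false ∷ P) (false ∷ Q) (suc v) u       = T x y P Q v (suc u) + T x y P Q (suc v) u
  T x y (false ∷ P) (true ∷ Q)  v       u       = T x y P Q v (suc u) + T x y P Q (suc v) u
  T x y (true ∷ P)  (false ∷ Q) zero    zero    = 0
  T x y (true ∷ P)  (false ∷ Q) zero    (suc u) = y * T x y P Q zero u
  T x y (true ∷ P)  (false ∷ Q) (suc v) zero    = x * T x y P Q v zero
  T x y (true ∷ P)  (false ∷ Q) (suc v) (suc u) = T x y P Q v (suc u) + T x y P Q (suc v) u
  T x y (true ∷ P)  (true ∷ Q)  v       zero    = x * T x y P Q v zero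
  T x y (true ∷ P)  (true ∷ Q)  v       (suc u) = T x y P Q v (suc u) + T x y P Q (suc v) u

  -- The index w is the vertical distance of the starting points of P and Q.
  data Region : ∀ {n} → ℕ → Subset n → Subset n → Set where
    nil : Region 0 [] []
    EE  : ∀ {n w} {P Q : Subset n} → Region w P Q → Region w (false ∷ P) (false ∷ Q)
    EN  : ∀ {n w} {P Q : Subset n} → Region (suc w) P Q → Region w (false ∷ P) (true ∷ Q)
    NE  : ∀ {n w} {P Q : Subset n} → Region w P Q → Region (suc w) (true ∷ P) (false ∷ Q)
    NN  : ∀ {n w} {P Q : Subset n} → Region w P Q → Region w (true ∷ P) (true ∷ Q)

  -- Absence of loops (`b` true) or coloops (`b` false) in a form that passes to tails: the starting
  -- state is existential, because after the first step a path may be at any height between P and Q.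
  record Attains {n} (b : Bool) (w : ℕ) (P Q : Subset n) (e : Fin n) : Set where
    constructor attains
    field
      {v u}  : ℕ
      {B}    : Subset n
      width  : v + u ≡ w
      inside : within P Q v u B ≡ true
      value  : lookup B e ≡ b

  data Snakes : ∀ {n} → ℕ → Subset n → Subset n → Set where
    none  : Snakes 0 [] []
    snake : ∀ {n k} {P Q : Subset n} → Snakes k P Q → Snakes (suc k) (false ∷ true ∷ P) (true ∷ false ∷ Q)

  -- The invariant and its induction along the paths

  module _ {n : ℕ} (P Q : Subset n) where
    pairAt : ℕ → ℕ → Pair
    pairAt v u = pair (T 1 1 P Q v (suc u)) (T 1 1 P Q (suc v) u)
                      (T 2 0 P Q v (suc u)) (T 2 0 P Q (suc v) u)
                      (T 0 2 P Q v (suc u)) (T 0 2 P Q (suc v) u)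

    T₁₁ T₂₀ T₀₂ : ℕ
    T₁₁ = T 1 1 P Q 0 0
    T₂₀ = T 2 0 P Q 0 0
    T₀₂ = T 0 2 P Q 0 0

    -- The first bound is all that the next block needs from the blocks after it. A single
    -- nontrivial block supplies the factor 4/3, so the second component fails to give it only for a
    -- sum of trivial snakes.
    Closed : Set
    Closed = T₁₁ * T₁₁ ≤ T₂₀ * T₀₂ × (∃ (λ k → Snakes k P Q) ⊎ 4 * (T₁₁ * T₁₁) ≤ 3 * (T₂₀ * T₀₂))

  -- P and Q have separated at distance 1 after their last meeting point: the pair is that
  -- of a trivial snake, for which only the constant 1 is available.
  data Fresh : ∀ {n} → Subset n → Subset n → Set where
    fresh : ∀ {n} {P Q : Subset n} → Closed P Q → Fresh (true ∷ P) (false ∷ Q)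

  -- At distance w there are w + 1 states, hence w adjacent pairs. Only the single pair at distance
  -- 1 can be that of a bare trivial snake, for which the cone bounds fail.
  Invariant : ∀ {n} → ℕ → Subset n → Subset n → Set
  Invariant 0             P Q = Closed P Q
  Invariant 1             P Q = Fresh P Q ⊎ Snakelike (pairAt P Q 0 0)
  Invariant (suc (suc w)) P Q = ∀ v u → v + u ≡ suc w → Snakelike (pairAt P Q v u)

  attains-tail-EE : ∀ {n b w e} {P Q : Subset n} →
    Attains b w (false ∷ P) (false ∷ Q) (suc e) → Attains b w P Q e
  attains-tail-EE (attains {v} {u} {false ∷ B} w≡ in-R val) = attains {v = v} {u} {B} w≡ in-R val
  attains-tail-EE (attains {suc v} {u} {true ∷ B} w≡ in-R val) =
    attains {v = v} {suc u} {B} (trans (+-suc v u) w≡) in-R val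

  attains-tail-EN : ∀ {n b w e} {P Q : Subset n} →
    Attains b w (false ∷ P) (true ∷ Q) (suc e) → Attains b (suc w) P Q e
  attains-tail-EN (attains {v} {u} {false ∷ B} w≡ in-R val) =
    attains {v = suc v} {u} {B} (cong suc w≡) in-R val
  attains-tail-EN (attains {v} {u} {true ∷ B} w≡ in-R val) =
    attains {v = v} {suc u} {B} (trans (+-suc v u) (cong suc w≡)) in-R val

  attains-tail-NE : ∀ {n b w e} {P Q : Subset n} →
    Attains b (suc w) (true ∷ P) (false ∷ Q) (suc e) → Attains b w P Q e
  attains-tail-NE (attains {v} {suc u} {false ∷ B} w≡ in-R val) =
    attains {v = v} {u} {B} (suc-injective (trans (sym (+-suc v u)) w≡)) in-R val
  attains-tail-NE (attains {suc v} {zero} {true ∷ B} w≡ in-R val) =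
    attains {v = v} {zero} {B} (suc-injective w≡) in-R val
  attains-tail-NE (attains {suc v} {suc u} {true ∷ B} w≡ in-R val) =
    attains {v = v} {suc u} {B} (suc-injective w≡) in-R val

  attains-tail-NN : ∀ {n b w e} {P Q : Subset n} →
    Attains b w (true ∷ P) (true ∷ Q) (suc e) → Attains b w P Q e
  attains-tail-NN (attains {v} {suc u} {false ∷ B} w≡ in-R val) =
    attains {v = suc v} {u} {B} (trans (sym (+-suc v u)) w≡) in-R val
  attains-tail-NN (attains {v} {u} {true ∷ B} w≡ in-R val) = attains {v = v} {u} {B} w≡ in-R val

  loop : ∀ {n} {P Q : Subset n} → ¬ Attains true 0 (false ∷ P) (false ∷ Q) zero
  loop (attains {zero} {B = true ∷ B} _ () _)

  coloop : ∀ {n} {P Q : Subset n} → ¬ Attains false 0 (true ∷ P) (true ∷ Q) zero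
  coloop (attains {zero} {zero} {false ∷ B} _ () _)

  4/3⇒1 : ∀ a b c → 4 * (a * a) ≤ 3 * (b * c) → a * a ≤ b * c
  4/3⇒1 a b c h = *-cancelˡ-≤ 3 (≤-trans (*-monoˡ-≤ (a * a) (n≤1+n 3)) h)

  -- A trivial snake doubles each of the three values, so both sides of every bound are multiplied
  -- by 4.
  closed-snake : ∀ {n} {P Q : Subset n} → Closed P Q → Closed (false ∷ true ∷ P) (true ∷ false ∷ Q)
  closed-snake {P = P} {Q} (weak , strong) =
    subst₂ _≤_ (a-eq a) (bc-eq b c) (*-monoʳ-≤ 4 weak) ,
    Sum.map (λ (k , s) → suc k , snake s)
      (λ h → subst₂ _≤_ (a-eq′ a) (bc-eq′ b c) (*-monoʳ-≤ 4 h)) strong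
    where
    a = T₁₁ P Q ; b = T₂₀ P Q ; c = T₀₂ P Q
    a-eq : ∀ a → 4 * (a * a) ≡ (1 * a + 1 * a) * (1 * a + 1 * a)
    a-eq = solve-∀
    bc-eq : ∀ b c → 4 * (b * c) ≡ (0 * b + 2 * b) * (2 * c + 0 * c)
    bc-eq = solve-∀
    a-eq′ : ∀ a → 4 * (4 * (a * a)) ≡ 4 * ((1 * a + 1 * a) * (1 * a + 1 * a))
    a-eq′ = solve-∀
    bc-eq′ : ∀ b c → 4 * (3 * (b * c)) ≡ 3 * ((0 * b + 2 * b) * (2 * c + 0 * c))
    bc-eq′ = solve-∀

  fresh⇒snakelike-east : ∀ {n} {P Q : Subset n} →
    Fresh P Q → Snakelike (east (pairAt P Q 0 0))
  fresh⇒snakelike-east (fresh {P = P} {Q} (weak , _)) = snakelike-east-initial (T₁₁ P Q) (T₂₀ P Q) (T₀₂ P Q) weak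

  fresh⇒snakelike-north : ∀ {n} {P Q : Subset n} →
    Fresh P Q → Snakelike (north (pairAt P Q 0 0))
  fresh⇒snakelike-north (fresh {P = P} {Q} (weak , _)) = snakelike-north-initial (T₁₁ P Q) (T₂₀ P Q) (T₀₂ P Q) weak

  invariant-east : ∀ {n} {P Q : Subset n} w → Invariant (suc w) P Q → Snakelike (east (pairAt P Q 0 w))
  invariant-east zero    (inj₁ f) = fresh⇒snakelike-east f
  invariant-east zero    (inj₂ s) = snakelike-east s
  invariant-east (suc w) inv      = snakelike-east (inv 0 (suc w) refl)

  invariant-north : ∀ {n} {P Q : Subset n} w → Invariant (suc w) P Q → Snakelike (north (pairAt P Q w 0))
  invariant-north zero    (inj₁ f) = fresh⇒snakelike-north f
  invariant-north zero    (inj₂ s) = snakelike-north s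
  invariant-north (suc w) inv      = snakelike-north (inv (suc w) 0 (+-identityʳ (suc w)))

  -- Two neighbouring pairs exist only from distance 2 on, where no fresh pair remains; this is what
  -- `suc (v + u) ≡ w` ensures.
  invariant-⊞ : ∀ {n} {P Q : Subset n} w → Invariant (suc w) P Q →
    ∀ v u → suc (v + u) ≡ w → Snakelike (pairAt P Q v (suc u) ⊞ pairAt P Q (suc v) u)
  invariant-⊞ (suc w) inv v u refl = snakelike-⊞ (inv v (suc u) (+-suc v u)) (inv (suc v) u refl)

  AllSnakelike : ∀ {n} → ℕ → Subset n → Subset n → Set
  AllSnakelike w P Q = ∀ v u → v + u ≡ w → Snakelike (pairAt P Q v u)

  snakelike⇒invariant : ∀ {n} {P Q : Subset n} w → AllSnakelike w P Q → Invariant (suc w) P Q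
  snakelike⇒invariant zero    all = inj₂ (all 0 0 refl)
  snakelike⇒invariant (suc w) all = all

  -- The recursion on tails builds the region backwards from the common end: `NE` widens it and `EN`
  -- narrows it. A pair touching Q when Q goes east is an `east`, one touching P when P goes north
  -- is a `north`, every other one is a sum of two neighbouring pairs. At distance 0, `EE` would be
  -- a loop and `NN` a coloop.
  invariant : ∀ {n w} {P Q : Subset n} → Region w P Q → (∀ b e → Attains b w P Q e) → Invariant w P Q
  invariant nil _ = s≤s z≤n , inj₁ (0 , none)
  invariant {w = zero}  (EE R) att = contradiction (att true zero) loop
  invariant {w = suc w} {false ∷ P} {false ∷ Q} (EE R) att = snakelike⇒invariant w all
    where
    inv = invariant R (λ b e → attains-tail-EE (att b (suc e)))
    all : AllSnakelike w (false ∷ P) (false ∷ Q)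
    all zero    u refl = invariant-east w inv
    all (suc v) u eq   = invariant-⊞ w inv v u eq
  invariant {w = zero} {P} {Q} (EN R) att with invariant R (λ b e → attains-tail-EN (att b (suc e)))
  ... | inj₁ (fresh c) = closed-snake c
  -- The paths meet here, and deletion-contraction makes each value the sum over the only pair.
  ... | inj₂ s         = 4/3⇒1 (T₁₁ P Q) (T₂₀ P Q) (T₀₂ P Q) (snakelike⇒4/3 s) , inj₂ (snakelike⇒4/3 s)
  invariant {w = suc w} {false ∷ P} {true ∷ Q} (EN R) att =
    snakelike⇒invariant w λ v u eq →
      invariant-⊞ {P = P} {Q} (suc w) (invariant R (λ b e → attains-tail-EN (att b (suc e)))) v u (cong suc eq)
  invariant {w = suc zero} (NE R) att =
    inj₁ (fresh (invariant R (λ b e → attains-tail-NE (att b (suc e)))))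
  invariant {w = suc (suc w)} {true ∷ P} {false ∷ Q} (NE R) att = all
    where
    inv = invariant R (λ b e → attains-tail-NE (att b (suc e)))
    all : AllSnakelike (suc w) (true ∷ P) (false ∷ Q)
    all zero    (suc u) refl = invariant-east w inv
    all (suc v) zero    eq   with refl ← trans (sym (+-identityʳ v)) (suc-injective eq) = invariant-north w inv
    all (suc v) (suc u) eq   = invariant-⊞ w inv v u (trans (sym (+-suc v u)) (suc-injective eq))
  invariant {w = zero}  (NN R) att = contradiction (att false zero) coloop
  invariant {w = suc w} {true ∷ P} {true ∷ Q} (NN R) att = snakelike⇒invariant w all
    where
    inv = invariant R (λ b e → attains-tail-NN (att b (suc e)))
    all : AllSnakelike w (true ∷ P) (true ∷ Q)
    all v zero    eq with refl ← trans (sym (+-identityʳ v)) eq = invariant-north w inv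
    all v (suc u) eq = invariant-⊞ w inv v u (trans (sym (+-suc v u)) eq)

  -- Ranks and deletion–contraction

  ∈-allSubsets : ∀ {n} (A : Subset n) → A ∈ allSubsets n
  ∈-allSubsets []          = here refl
  ∈-allSubsets (true ∷ A)  = ∈-++⁺ˡ (∈-map⁺ (true ∷_) (∈-allSubsets A))
  ∈-allSubsets (false ∷ A) = ∈-++⁺ʳ _ (∈-map⁺ (false ∷_) (∈-allSubsets A))

  module _ {X : Set} (f : X → ℕ) where
    max-upper : ∀ {x xs} → x ∈ xs → f x ≤ foldr _⊔_ 0 (map f xs)
    max-upper (here refl) = m≤m⊔n _ _
    max-upper {xs = y ∷ _} (there x∈xs) = ≤-trans (max-upper x∈xs) (m≤n⊔m (f y) _)

    max-least : ∀ {k} xs → (∀ x → f x ≤ k) → foldr _⊔_ 0 (map f xs) ≤ k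
    max-least []       f≤k = z≤n
    max-least (x ∷ xs) f≤k = ⊔-lub (f≤k x) (max-least xs f≤k)

  Nonempty : ∀ {n} → BasisSystem n → Set
  Nonempty M = ∃ λ B → M B ≡ true

  module _ {n} (M : BasisSystem n) where
    rank-upper : ∀ A {B} → M B ≡ true → ∣ A ∩ B ∣ ≤ rank M A
    rank-upper A {B} MB =
      subst (_≤ rank M A) (cong (λ b → if b then ∣ A ∩ B ∣ else 0) MB)
        (max-upper (λ B → if M B then ∣ A ∩ B ∣ else 0) (∈-allSubsets B))

    rank-least : ∀ A {k} → (∀ B → M B ≡ true → ∣ A ∩ B ∣ ≤ k) → rank M A ≤ k
    rank-least A {k} h = max-least _ (allSubsets n) bound
      where
      bound : ∀ B → (if M B then ∣ A ∩ B ∣ else 0) ≤ k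
      bound B with M B in MB
      ... | true  = h B MB
      ... | false = z≤n

    rank≤card : ∀ A → rank M A ≤ ∣ A ∣
    rank≤card A = rank-least A λ B _ → ∣p∩q∣≤∣p∣ A B

    -- Without a basis the maximum takes its default value 0, and `suc` would break the bound; hence
    -- `Nonempty`.
    suc-rank-least : ∀ A {k} → Nonempty M → (∀ B → M B ≡ true → suc ∣ A ∩ B ∣ ≤ k) → suc (rank M A) ≤ k
    suc-rank-least A {zero}  (B , MB) h = contradiction (h B MB) λ ()
    suc-rank-least A {suc k} _        h = s≤s (rank-least A λ B MB → s≤s⁻¹ (h B MB))

    rank-∅ : (∀ B → M B ≡ false) → ∀ A → rank M A ≡ 0
    rank-∅ empty A = n≤0⇒n≡0 (rank-least A λ B MB → contradiction (trans (sym MB) (empty B)) λ ())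

  full-∩ : ∀ {n} (B : Subset n) → fullSet n ∩ B ≡ B
  full-∩ []      = refl
  full-∩ (b ∷ B) = cong (b ∷_) (full-∩ B)

  rank≤rank-full : ∀ {n} (M : BasisSystem n) A → rank M A ≤ rank M (fullSet n)
  rank≤rank-full M A = rank-least M A λ B MB →
    ≤-trans (∣p∩q∣≤∣q∣ A B)
      (subst (λ X → ∣ X ∣ ≤ rank M (fullSet _)) (full-∩ B) (rank-upper M (fullSet _) MB))

  contract delete : ∀ {n} → BasisSystem (suc n) → BasisSystem n
  contract M B = M (true ∷ B)
  delete M B = M (false ∷ B)

  module _ {n} (M : BasisSystem (suc n)) where
    -- The bases are split by whether they contain the first element; no exchange axiom enters, so
    -- this holds for every family of sets.
    rank-without : ∀ A → rank M (false ∷ A) ≡ rank (contract M) A ⊔ rank (delete M) A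
    rank-without A = ≤-antisym
      (rank-least M (false ∷ A) λ where
        (true ∷ B)  MB → ≤-trans (rank-upper (contract M) A MB) (m≤m⊔n _ _)
        (false ∷ B) MB → ≤-trans (rank-upper (delete M) A MB) (m≤n⊔m (rank (contract M) A) _))
      (⊔-lub (rank-least (contract M) A λ B MB → rank-upper M (false ∷ A) MB)
             (rank-least (delete M) A λ B MB → rank-upper M (false ∷ A) MB))

    rank-with : Nonempty (contract M) →
      ∀ A → rank M (true ∷ A) ≡ suc (rank (contract M) A) ⊔ rank (delete M) A
    rank-with ne A = ≤-antisym
      (rank-least M (true ∷ A) λ where
        (true ∷ B)  MB → ≤-trans (s≤s (rank-upper (contract M) A MB)) (m≤m⊔n _ (rank (delete M) A))
        (false ∷ B) MB → ≤-trans (rank-upper (delete M) A MB) (m≤n⊔m (suc (rank (contract M) A)) _))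
      (⊔-lub (suc-rank-least (contract M) A ne λ B MB → rank-upper M (true ∷ A) MB)
             (rank-least (delete M) A λ B MB → rank-upper M (true ∷ A) MB))

    rank-with-loop : (∀ B → contract M B ≡ false) → ∀ A → rank M (true ∷ A) ≡ rank (delete M) A
    rank-with-loop empty A = ≤-antisym
      (rank-least M (true ∷ A) λ where
        (true ∷ B)  MB → contradiction (trans (sym MB) (empty B)) λ ()
        (false ∷ B) MB → rank-upper (delete M) A MB)
      (rank-least (delete M) A λ B MB → rank-upper M (true ∷ A) MB)

  Σ-of : ∀ {X : Set} → (X → ℤ) → List X → ℤ
  Σ-of f xs = foldr ℤ._+_ (+ 0) (map f xs)

  Σ-++ : ∀ {X : Set} (f : X → ℤ) xs ys → Σ-of f (xs ++ ys) ≡ Σ-of f xs ℤ.+ Σ-of f ys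
  Σ-++ f []       ys = sym (ℤ.+-identityˡ _)
  Σ-++ f (x ∷ xs) ys = trans (cong (λ s → f x ℤ.+ s) (Σ-++ f xs ys)) (sym (ℤ.+-assoc (f x) _ _))

  Σ-cong : ∀ {X : Set} {f g : X → ℤ} → f ≗ g → ∀ xs → Σ-of f xs ≡ Σ-of g xs
  Σ-cong f≗g xs = cong (foldr ℤ._+_ (+ 0)) (map-cong f≗g xs)

  Σ-* : ∀ {X : Set} z (f : X → ℤ) xs → Σ-of (λ x → z ℤ.* f x) xs ≡ z ℤ.* Σ-of f xs
  Σ-* z f []       = sym (ℤ.*-zeroʳ z)
  Σ-* z f (x ∷ xs) = trans (cong (λ s → z ℤ.* f x ℤ.+ s) (Σ-* z f xs)) (sym (ℤ.*-distribˡ-+ z (f x) _))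

  Σ-allSubsets : ∀ {n} (f : Subset (suc n) → ℤ) →
    Σ-of f (allSubsets (suc n)) ≡
    Σ-of (λ A → f (true ∷ A)) (allSubsets n) ℤ.+ Σ-of (λ A → f (false ∷ A)) (allSubsets n)
  Σ-allSubsets {n} f = trans (Σ-++ f (map (true ∷_) (allSubsets n)) _)
    (sym (cong₂ ℤ._+_ (cong (foldr ℤ._+_ (+ 0)) (map-∘ (allSubsets n)))
                      (cong (foldr ℤ._+_ (+ 0)) (map-∘ (allSubsets n)))))

  module _ {n} (M : BasisSystem (suc n)) (x y : ℤ) where
    private
      r = rank M
      r/ = rank (contract M)
      r∖ = rank (delete M)

      term : ℕ → ℕ → ℤ
      term i j = (x ℤ.- + 1) ℤ.^ i ℤ.* (y ℤ.- + 1) ℤ.^ j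

    -- The rank hypotheses stand in for the matroid axioms at an element that is neither loop nor
    -- coloop. They decide both maxima in the rank formulas and show that contraction has full rank
    -- exactly one less than deletion.
    tutte-deletion-contraction :
      Nonempty (contract M) →
      (∀ A → rank (contract M) A ≤ rank (delete M) A) →
      (∀ A → rank (delete M) A ≤ suc (rank (contract M) A)) →
      suc (rank (contract M) (fullSet n)) ≤ rank (delete M) (fullSet n) →
      tutte M x y ≡ tutte (contract M) x y ℤ.+ tutte (delete M) x y
    tutte-deletion-contraction ne /≤∖ ∖≤1+/ full = trans (Σ-allSubsets {n} _)
      (cong₂ ℤ._+_
        (Σ-cong (λ A → cong₂ (λ s t → term (s ∸ t) (suc ∣ A ∣ ∸ t)) (with-e (fullSet n)) (with-e A))
          (allSubsets n))
        (Σ-cong (λ A → cong₂ (λ s t → term (s ∸ t) (∣ A ∣ ∸ t))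
                         (trans (with-e (fullSet n)) (≤-antisym full (∖≤1+/ (fullSet n)))) (without-e A))
          (allSubsets n)))
      where
      with-e : ∀ A → r (true ∷ A) ≡ suc (r/ A)
      with-e A = trans (rank-with M ne A) (m≥n⇒m⊔n≡m (∖≤1+/ A))
      without-e : ∀ A → r (false ∷ A) ≡ r∖ A
      without-e A = trans (rank-without M A) (m≤n⇒m⊔n≡n (/≤∖ A))

    tutte-loop : (∀ B → contract M B ≡ false) → tutte M x y ≡ y ℤ.* tutte (delete M) x y
    tutte-loop empty = begin
      tutte M x y
        ≡⟨ Σ-allSubsets {n} _ ⟩
      _ ≡⟨ cong₂ ℤ._+_ (trans (Σ-cong with-eq (allSubsets n)) (Σ-* (y ℤ.- + 1) _ (allSubsets n)))
                       (Σ-cong without-eq (allSubsets n)) ⟩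
      (y ℤ.- + 1) ℤ.* tutte (delete M) x y ℤ.+ tutte (delete M) x y
        ≡⟨ collect y (tutte (delete M) x y) ⟩
      y ℤ.* tutte (delete M) x y ∎
      where
      open ≡-Reasoning
      collect : ∀ y t → (y ℤ.- + 1) ℤ.* t ℤ.+ t ≡ y ℤ.* t
      collect = ℤ.solve-∀
      pull : ∀ a b c → a ℤ.* (b ℤ.* c) ≡ b ℤ.* (a ℤ.* c)
      pull = ℤ.solve-∀
      with-e : ∀ A → r (true ∷ A) ≡ r∖ A
      with-e = rank-with-loop M empty
      without-e : ∀ A → r (false ∷ A) ≡ r∖ A
      without-e A = trans (rank-without M A) (cong (_⊔ r∖ A) (rank-∅ (contract M) empty A))
      with-eq : ∀ A → term (r (fullSet (suc n)) ∸ r (true ∷ A)) (suc ∣ A ∣ ∸ r (true ∷ A)) ≡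
                      (y ℤ.- + 1) ℤ.* term (r∖ (fullSet n) ∸ r∖ A) (∣ A ∣ ∸ r∖ A)
      with-eq A rewrite with-e (fullSet n) | with-e A | +-∸-assoc 1 (rank≤card (delete M) A) =
        pull ((x ℤ.- + 1) ℤ.^ (r∖ (fullSet n) ∸ r∖ A)) (y ℤ.- + 1) ((y ℤ.- + 1) ℤ.^ (∣ A ∣ ∸ r∖ A))
      without-eq : ∀ A → term (r (fullSet (suc n)) ∸ r (false ∷ A)) (∣ A ∣ ∸ r (false ∷ A)) ≡
                         term (r∖ (fullSet n) ∸ r∖ A) (∣ A ∣ ∸ r∖ A)
      without-eq A rewrite with-e (fullSet n) | without-e A = refl

    tutte-coloop : Nonempty (contract M) → (∀ B → delete M B ≡ false) →
      tutte M x y ≡ x ℤ.* tutte (contract M) x y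
    tutte-coloop ne empty = begin
      tutte M x y
        ≡⟨ Σ-allSubsets {n} _ ⟩
      _ ≡⟨ cong₂ ℤ._+_ (Σ-cong with-eq (allSubsets n))
                       (trans (Σ-cong without-eq (allSubsets n)) (Σ-* (x ℤ.- + 1) _ (allSubsets n))) ⟩
      tutte (contract M) x y ℤ.+ (x ℤ.- + 1) ℤ.* tutte (contract M) x y
        ≡⟨ collect x (tutte (contract M) x y) ⟩
      x ℤ.* tutte (contract M) x y ∎
      where
      open ≡-Reasoning
      collect : ∀ x t → t ℤ.+ (x ℤ.- + 1) ℤ.* t ≡ x ℤ.* t
      collect = ℤ.solve-∀
      with-e : ∀ A → r (true ∷ A) ≡ suc (r/ A)
      with-e A = trans (rank-with M ne A)
        (trans (cong (suc (r/ A) ⊔_) (rank-∅ (delete M) empty A)) (⊔-identityʳ _))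
      without-e : ∀ A → r (false ∷ A) ≡ r/ A
      without-e A = trans (rank-without M A)
        (trans (cong (r/ A ⊔_) (rank-∅ (delete M) empty A)) (⊔-identityʳ _))
      with-eq : ∀ A → term (r (fullSet (suc n)) ∸ r (true ∷ A)) (suc ∣ A ∣ ∸ r (true ∷ A)) ≡
                      term (r/ (fullSet n) ∸ r/ A) (∣ A ∣ ∸ r/ A)
      with-eq A rewrite with-e (fullSet n) | with-e A = refl
      without-eq : ∀ A → term (r (fullSet (suc n)) ∸ r (false ∷ A)) (∣ A ∣ ∸ r (false ∷ A)) ≡
                         (x ℤ.- + 1) ℤ.* term (r/ (fullSet n) ∸ r/ A) (∣ A ∣ ∸ r/ A)
      without-eq A rewrite with-e (fullSet n) | without-e A
                         | +-∸-assoc 1 (rank≤rank-full (contract M) A) =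
        ℤ.*-assoc (x ℤ.- + 1) _ _

  -- The Tutte polynomial of a region

  -- Only the effect on ranks is recorded. The raised path starts one unit below `B`, follows its
  -- initial north run and joins it at its first east step; it stays above P because P does not gain
  -- on a path going north.
  Raised : ∀ {n} → Subset n → Subset n → Set
  Raised B B′ = ∣ B′ ∣ ≡ suc ∣ B ∣ × (∀ A → ∣ A ∩ B ∣ ≤ ∣ A ∩ B′ ∣)

  raised-here : ∀ {n} {B : Subset n} → Raised (false ∷ B) (true ∷ B)
  raised-here = refl , λ where
    (false ∷ A) → ≤-refl
    (true ∷ A)  → n≤1+n _

  raised-there : ∀ {n} {B B′ : Subset n} → Raised B B′ → Raised (true ∷ B) (true ∷ B′)
  raised-there (card , mono) = cong suc card , λ where
    (false ∷ A) → mono A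
    (true ∷ A)  → s≤s (mono A)

  -- B′ is B with its first east step turned north.
  raise : ∀ {n} (P Q : Subset n) v u B → within P Q v (suc u) B ≡ true →
    ∃ λ B′ → within P Q (suc v) u B′ ≡ true × Raised B B′
  raise []          []          zero    u       [] ()
  raise []          []          (suc v) u       [] ()
  raise (false ∷ P) (false ∷ Q) v       u       (false ∷ B) h = true ∷ B , h , raised-here
  raise (false ∷ P) (false ∷ Q) (suc v) u       (true ∷ B)  h =
    let B′ , h′ , r = raise P Q v (suc u) B h in true ∷ B′ , h′ , raised-there r
  raise (false ∷ P) (true ∷ Q)  v       u       (false ∷ B) h = true ∷ B , h , raised-here
  raise (false ∷ P) (true ∷ Q)  v       u       (true ∷ B)  h =
    let B′ , h′ , r = raise P Q v (suc u) B h in true ∷ B′ , h′ , raised-there r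
  raise (true ∷ P)  (false ∷ Q) v       zero    (false ∷ B) h = true ∷ B , h , raised-here
  raise (true ∷ P)  (false ∷ Q) v       (suc u) (false ∷ B) h = true ∷ B , h , raised-here
  raise (true ∷ P)  (false ∷ Q) (suc v) zero    (true ∷ B)  h =
    let B′ , h′ , r = raise P Q v zero B h in true ∷ B′ , h′ , raised-there r
  raise (true ∷ P)  (false ∷ Q) (suc v) (suc u) (true ∷ B)  h =
    let B′ , h′ , r = raise P Q v (suc u) B h in true ∷ B′ , h′ , raised-there r
  raise (true ∷ P)  (true ∷ Q)  v       u       (false ∷ B) h = true ∷ B , h , raised-here
  raise (true ∷ P)  (true ∷ Q)  v       u       (true ∷ B)  h =
    let B′ , h′ , r = raise P Q v u B h in true ∷ B′ , h′ , raised-there r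

  -- The mirror image: the lowered path starts one unit above `B` and follows its initial east run,
  -- along which the distance to Q does not shrink.
  Lowered : ∀ {n} → Subset n → Subset n → Set
  Lowered B B′ = ∀ A → ∣ A ∩ B ∣ ≤ suc ∣ A ∩ B′ ∣

  lowered-here : ∀ {n} {B : Subset n} → Lowered (true ∷ B) (false ∷ B)
  lowered-here (false ∷ A) = n≤1+n _
  lowered-here (true ∷ A)  = ≤-refl

  lowered-there : ∀ {n} {B B′ : Subset n} → Lowered B B′ → Lowered (false ∷ B) (false ∷ B′)
  lowered-there l (false ∷ A) = l A
  lowered-there l (true ∷ A)  = l A

  -- B′ is B with its first north step turned east.
  lower : ∀ {n} (P Q : Subset n) v u B → within P Q (suc v) u B ≡ true →
    ∃ λ B′ → within P Q v (suc u) B′ ≡ true × Lowered B B′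
  lower []          []          v       u       [] ()
  lower (false ∷ P) (false ∷ Q) v       u       (true ∷ B)  h = false ∷ B , h , lowered-here
  lower (false ∷ P) (false ∷ Q) v       u       (false ∷ B) h =
    let B′ , h′ , l = lower P Q v u B h in false ∷ B′ , h′ , lowered-there l
  lower (false ∷ P) (true ∷ Q)  v       u       (true ∷ B)  h = false ∷ B , h , lowered-here
  lower (false ∷ P) (true ∷ Q)  v       u       (false ∷ B) h =
    let B′ , h′ , l = lower P Q (suc v) u B h in false ∷ B′ , h′ , lowered-there l
  lower (true ∷ P)  (false ∷ Q) v       zero    (true ∷ B)  h = false ∷ B , h , lowered-here
  lower (true ∷ P)  (false ∷ Q) v       (suc u) (true ∷ B)  h = false ∷ B , h , lowered-here
  lower (true ∷ P)  (false ∷ Q) v       (suc u) (false ∷ B) h =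
    let B′ , h′ , l = lower P Q v u B h in false ∷ B′ , h′ , lowered-there l
  lower (true ∷ P)  (true ∷ Q)  v       u       (true ∷ B)  h = false ∷ B , h , lowered-here
  lower (true ∷ P)  (true ∷ Q)  v       (suc u) (false ∷ B) h =
    let B′ , h′ , l = lower P Q (suc v) u B h in false ∷ B′ , h′ , lowered-there l

  nonempty : ∀ {n w} {P Q : Subset n} → Region w P Q → ∀ v u → v + u ≡ w → Nonempty (within P Q v u)
  nonempty nil zero zero refl = [] , refl
  nonempty (EE R) v u eq = let B , h = nonempty R v u eq in false ∷ B , h
  nonempty (EN R) v u eq = let B , h = nonempty R (suc v) u (cong suc eq) in false ∷ B , h
  nonempty (NE R) v (suc u) eq =
    let B , h = nonempty R v u (suc-injective (trans (sym (+-suc v u)) eq)) in false ∷ B , h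
  nonempty (NE R) (suc v) zero eq =
    let B , h = nonempty R v zero (suc-injective eq) in true ∷ B , h
  nonempty (NN R) v u eq = let B , h = nonempty R v u eq in true ∷ B , h

  module _ {n : ℕ} (P Q : Subset n) (v u : ℕ) where
    private
      high = within P Q v (suc u)
      low = within P Q (suc v) u

    rank-high≤rank-low : ∀ A → rank high A ≤ rank low A
    rank-high≤rank-low A = rank-least high A λ B h →
      let B′ , h′ , _ , mono = raise P Q v u B h in ≤-trans (mono A) (rank-upper low A h′)

    rank-low≤1+rank-high : ∀ A → rank low A ≤ suc (rank high A)
    rank-low≤1+rank-high A = rank-least low A λ B h →
      let B′ , h′ , mono = lower P Q v u B h in ≤-trans (mono A) (s≤s (rank-upper high A h′))

    1+full-rank-high≤full-rank-low : Nonempty high →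
      suc (rank high (fullSet n)) ≤ rank low (fullSet n)
    1+full-rank-high≤full-rank-low ne = suc-rank-least high (fullSet n) ne λ B h →
      let B′ , h′ , card , _ = raise P Q v u B h
      in subst (_≤ rank low (fullSet n))
           (trans (cong ∣_∣ (full-∩ B′)) (trans card (cong (λ X → suc ∣ X ∣) (sym (full-∩ B)))))
           (rank-upper low (fullSet n) h′)

  module _ (x y : ℕ) where
    tutte-branch : ∀ {n w} {P Q : Subset n} (M : BasisSystem (suc n)) v u →
      Region w P Q → suc (v + u) ≡ w →
      contract M ≡ within P Q v (suc u) → delete M ≡ within P Q (suc v) u →
      tutte (within P Q v (suc u)) (+ x) (+ y) ≡ + T x y P Q v (suc u) →
      tutte (within P Q (suc v) u) (+ x) (+ y) ≡ + T x y P Q (suc v) u →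
      tutte M (+ x) (+ y) ≡ + (T x y P Q v (suc u) + T x y P Q (suc v) u)
    tutte-branch {n} {P = P} {Q} M v u R eq C≡ D≡ ih₁ ih₂ =
      trans (minors C≡ D≡ ne
              (rank-high≤rank-low P Q v u) (rank-low≤1+rank-high P Q v u)
              (1+full-rank-high≤full-rank-low P Q v u ne))
            (cong₂ ℤ._+_ ih₁ ih₂)
      where
      ne = nonempty R v (suc u) (trans (+-suc v u) eq)
      -- The minors are generalised to variables so that both equations can be matched with `refl`.
      minors : ∀ {C D} → contract M ≡ C → delete M ≡ D → Nonempty C →
        (∀ A → rank C A ≤ rank D A) → (∀ A → rank D A ≤ suc (rank C A)) →
        suc (rank C (fullSet n)) ≤ rank D (fullSet n) →
        tutte M (+ x) (+ y) ≡ tutte C (+ x) (+ y) ℤ.+ tutte D (+ x) (+ y)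
      minors refl refl = tutte-deletion-contraction M (+ x) (+ y)

    tutte-within : ∀ {n w} {P Q : Subset n} → Region w P Q → ∀ v u → v + u ≡ w →
      tutte (within P Q v u) (+ x) (+ y) ≡ + T x y P Q v u
    tutte-within nil zero zero refl = refl
    tutte-within {P = false ∷ P} {false ∷ Q} (EE R) zero u eq =
      trans (tutte-loop (within (false ∷ P) (false ∷ Q) zero u) (+ x) (+ y) (λ _ → refl))
        (trans (cong (+ y ℤ.*_) (tutte-within R zero u eq)) (sym (ℤ.pos-* y _)))
    tutte-within (EE R) (suc v) u eq =
      tutte-branch _ v u R eq refl refl
        (tutte-within R v (suc u) (trans (+-suc v u) eq)) (tutte-within R (suc v) u eq)
    tutte-within (EN R) v u eq =
      tutte-branch _ v u R (cong suc eq) refl refl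
        (tutte-within R v (suc u) (trans (+-suc v u) (cong suc eq)))
        (tutte-within R (suc v) u (cong suc eq))
    tutte-within {P = true ∷ P} {false ∷ Q} (NE R) zero (suc u) eq =
      trans (tutte-loop (within (true ∷ P) (false ∷ Q) zero (suc u)) (+ x) (+ y) (λ _ → refl))
        (trans (cong (+ y ℤ.*_) (tutte-within R zero u (suc-injective eq))) (sym (ℤ.pos-* y _)))
    tutte-within {P = true ∷ P} {false ∷ Q} (NE R) (suc v) zero eq =
      trans (tutte-coloop (within (true ∷ P) (false ∷ Q) (suc v) zero) (+ x) (+ y)
              (nonempty R v zero (suc-injective eq)) (λ _ → refl))
        (trans (cong (+ x ℤ.*_) (tutte-within R v zero (suc-injective eq))) (sym (ℤ.pos-* x _)))
    tutte-within (NE R) (suc v) (suc u) eq =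
      tutte-branch _ v u R (trans (sym (+-suc v u)) (suc-injective eq)) refl refl
        (tutte-within R v (suc u) (suc-injective eq))
        (tutte-within R (suc v) u (trans (sym (+-suc v u)) (suc-injective eq)))
    tutte-within {P = true ∷ P} {true ∷ Q} (NN R) v zero eq =
      trans (tutte-coloop (within (true ∷ P) (true ∷ Q) v zero) (+ x) (+ y)
              (nonempty R v zero eq) (λ _ → refl))
        (trans (cong (+ x ℤ.*_) (tutte-within R v zero eq)) (sym (ℤ.pos-* x _)))
    tutte-within (NN R) v (suc u) eq =
      tutte-branch _ v u R (trans (sym (+-suc v u)) eq) refl refl
        (tutte-within R v (suc u) eq) (tutte-within R (suc v) u (trans (sym (+-suc v u)) eq))

  -- Lattice path matroids as regions

  bit : Bool → ℕ
  bit b = if b then 1 else 0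

  card-∷ : ∀ {n} b (B : Subset n) → ∣ b ∷ B ∣ ≡ bit b + ∣ B ∣
  card-∷ true  B = refl
  card-∷ false B = refl

  record Between {n} (P Q : Subset n) (v u : ℕ) (B : Subset n) : Set where
    constructor between
    field
      above : ∀ k → pre P k ≤ u + pre B k
      below : ∀ k → pre B k ≤ v + pre Q k
      endᴾ  : ∣ P ∣ ≡ u + ∣ B ∣
      endꟴ  : ∣ B ∣ ≡ v + ∣ Q ∣

  open Between

  shift : ∀ {u u′} p b c → p + u′ ≡ u + b → p + (u′ + c) ≡ u + (b + c)
  shift {u} {u′} p b c eq = trans (sym (+-assoc p u′ c)) (trans (cong (_+ c) eq) (+-assoc u b c))

  module _ {n} {P Q B : Subset n} (p q b : Bool) {v u v′ u′ : ℕ}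
           (u-eq : bit p + u′ ≡ u + bit b) (v-eq : bit b + v′ ≡ v + bit q) where

    private
      shiftᴮ : ∀ c → bit p + (u′ + c) ≡ u + (bit b + c)
      shiftᴮ c = shift (bit p) (bit b) c u-eq

      shiftꟴ : ∀ c → bit b + (v′ + c) ≡ v + (bit q + c)
      shiftꟴ c = shift (bit b) (bit q) c v-eq

    -- `u-eq` and `v-eq` are the updates u′ = u + b - p and v′ = v + q - b, with b, p, q the bits of
    -- the step, written without subtraction.
    between-∷ : Between P Q v′ u′ B → Between (p ∷ P) (q ∷ Q) v u (b ∷ B)
    between-∷ (between ab be eP eQ) = between
      (λ { zero    → z≤n
         ; (suc k) → subst (bit p + pre P k ≤_) (shiftᴮ (pre B k)) (+-monoʳ-≤ (bit p) (ab k)) })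
      (λ { zero    → z≤n
         ; (suc k) → subst (bit b + pre B k ≤_) (shiftꟴ (pre Q k)) (+-monoʳ-≤ (bit b) (be k)) })
      (begin
        ∣ p ∷ P ∣            ≡⟨ card-∷ p P ⟩
        bit p + ∣ P ∣        ≡⟨ cong (λ c → bit p + c) eP ⟩
        bit p + (u′ + ∣ B ∣) ≡⟨ shiftᴮ ∣ B ∣ ⟩
        u + (bit b + ∣ B ∣)  ≡⟨ cong (λ c → u + c) (card-∷ b B) ⟨
        u + ∣ b ∷ B ∣        ∎)
      (begin
        ∣ b ∷ B ∣            ≡⟨ card-∷ b B ⟩
        bit b + ∣ B ∣        ≡⟨ cong (λ c → bit b + c) eQ ⟩
        bit b + (v′ + ∣ Q ∣) ≡⟨ shiftꟴ ∣ Q ∣ ⟩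
        v + (bit q + ∣ Q ∣)  ≡⟨ cong (λ c → v + c) (card-∷ q Q) ⟨
        v + ∣ q ∷ Q ∣        ∎)
      where open ≡-Reasoning

    between-tail : Between (p ∷ P) (q ∷ Q) v u (b ∷ B) → Between P Q v′ u′ B
    between-tail (between ab be eP eQ) = between
      (λ k → +-cancelˡ-≤ (bit p) _ _
        (subst (bit p + pre P k ≤_) (sym (shiftᴮ (pre B k))) (ab (suc k))))
      (λ k → +-cancelˡ-≤ (bit b) _ _
        (subst (bit b + pre B k ≤_) (sym (shiftꟴ (pre Q k))) (be (suc k))))
      (+-cancelˡ-≡ (bit p) _ _ (begin
        bit p + ∣ P ∣        ≡⟨ card-∷ p P ⟨
        ∣ p ∷ P ∣            ≡⟨ eP ⟩
        u + ∣ b ∷ B ∣        ≡⟨ cong (λ c → u + c) (card-∷ b B) ⟩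
        u + (bit b + ∣ B ∣)  ≡⟨ shiftᴮ ∣ B ∣ ⟨
        bit p + (u′ + ∣ B ∣) ∎))
      (+-cancelˡ-≡ (bit b) _ _ (begin
        bit b + ∣ B ∣        ≡⟨ card-∷ b B ⟨
        ∣ b ∷ B ∣            ≡⟨ eQ ⟩
        v + ∣ q ∷ Q ∣        ≡⟨ cong (λ c → v + c) (card-∷ q Q) ⟩
        v + (bit q + ∣ Q ∣)  ≡⟨ shiftꟴ ∣ Q ∣ ⟨
        bit b + (v′ + ∣ Q ∣) ∎))
      where open ≡-Reasoning

  within⇒between : ∀ {n} (P Q : Subset n) v u B → within P Q v u B ≡ true → Between P Q v u B
  within⇒between [] [] zero zero [] _ = between (λ _ → z≤n) (λ _ → z≤n) refl refl
  within⇒between (false ∷ P) (false ∷ Q) v u (false ∷ B) h =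
    between-∷ false false false (sym (+-identityʳ u)) (sym (+-identityʳ v)) (within⇒between P Q v u B h)
  within⇒between (false ∷ P) (false ∷ Q) (suc v) u (true ∷ B) h =
    between-∷ false false true (+-comm 1 u) (sym (+-identityʳ (suc v))) (within⇒between P Q v (suc u) B h)
  within⇒between (false ∷ P) (true ∷ Q) v u (false ∷ B) h =
    between-∷ false true false (sym (+-identityʳ u)) (+-comm 1 v) (within⇒between P Q (suc v) u B h)
  within⇒between (false ∷ P) (true ∷ Q) v u (true ∷ B) h =
    between-∷ false true true (+-comm 1 u) (+-comm 1 v) (within⇒between P Q v (suc u) B h)
  within⇒between (true ∷ P) (false ∷ Q) v (suc u) (false ∷ B) h =
    between-∷ true false false (sym (+-identityʳ (suc u))) (sym (+-identityʳ v)) (within⇒between P Q v u B h)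
  within⇒between (true ∷ P) (false ∷ Q) (suc v) zero (true ∷ B) h =
    between-∷ true false true refl (sym (+-identityʳ (suc v))) (within⇒between P Q v zero B h)
  within⇒between (true ∷ P) (false ∷ Q) (suc v) (suc u) (true ∷ B) h =
    between-∷ true false true (+-comm 1 (suc u)) (sym (+-identityʳ (suc v))) (within⇒between P Q v (suc u) B h)
  within⇒between (true ∷ P) (true ∷ Q) v (suc u) (false ∷ B) h =
    between-∷ true true false (sym (+-identityʳ (suc u))) (+-comm 1 v) (within⇒between P Q (suc v) u B h)
  within⇒between (true ∷ P) (true ∷ Q) v u (true ∷ B) h =
    between-∷ true true true (+-comm 1 u) (+-comm 1 v) (within⇒between P Q v u B h)

  -- Both counts are 0, but `pre` reduces only once the vector is split. This refutes a first step
  -- that leaves the region.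
  pre-zero : ∀ {n} (A B : Subset n) → ¬ suc (pre A 0) ≤ pre B 0
  pre-zero []      []      ()
  pre-zero (_ ∷ _) (_ ∷ _) ()

  between⇒within : ∀ {n} (P Q : Subset n) v u B → Between P Q v u B → within P Q v u B ≡ true
  between⇒within [] [] zero zero [] _ = refl
  between⇒within [] [] zero (suc u) [] h with () ← endᴾ h
  between⇒within [] [] (suc v) u [] h with () ← endꟴ h
  between⇒within (false ∷ P) (false ∷ Q) v u (false ∷ B) h =
    between⇒within P Q v u B (between-tail false false false (sym (+-identityʳ u)) (sym (+-identityʳ v)) h)
  between⇒within (false ∷ P) (false ∷ Q) zero u (true ∷ B) h = contradiction (below h 1) (pre-zero B Q)
  between⇒within (false ∷ P) (false ∷ Q) (suc v) u (true ∷ B) h =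
    between⇒within P Q v (suc u) B (between-tail false false true (+-comm 1 u) (sym (+-identityʳ (suc v))) h)
  between⇒within (false ∷ P) (true ∷ Q) v u (false ∷ B) h =
    between⇒within P Q (suc v) u B (between-tail false true false (sym (+-identityʳ u)) (+-comm 1 v) h)
  between⇒within (false ∷ P) (true ∷ Q) v u (true ∷ B) h =
    between⇒within P Q v (suc u) B (between-tail false true true (+-comm 1 u) (+-comm 1 v) h)
  between⇒within (true ∷ P) (false ∷ Q) v zero (false ∷ B) h = contradiction (above h 1) (pre-zero P B)
  between⇒within (true ∷ P) (false ∷ Q) v (suc u) (false ∷ B) h =
    between⇒within P Q v u B (between-tail true false false (sym (+-identityʳ (suc u))) (sym (+-identityʳ v)) h)
  between⇒within (true ∷ P) (false ∷ Q) zero u (true ∷ B) h = contradiction (below h 1) (pre-zero B Q)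
  between⇒within (true ∷ P) (false ∷ Q) (suc v) zero (true ∷ B) h =
    between⇒within P Q v zero B (between-tail true false true refl (sym (+-identityʳ (suc v))) h)
  between⇒within (true ∷ P) (false ∷ Q) (suc v) (suc u) (true ∷ B) h =
    between⇒within P Q v (suc u) B (between-tail true false true (+-comm 1 (suc u)) (sym (+-identityʳ (suc v))) h)
  between⇒within (true ∷ P) (true ∷ Q) v zero (false ∷ B) h = contradiction (above h 1) (pre-zero P B)
  between⇒within (true ∷ P) (true ∷ Q) v (suc u) (false ∷ B) h =
    between⇒within P Q (suc v) u B (between-tail true true false (sym (+-identityʳ (suc u))) (+-comm 1 v) h)
  between⇒within (true ∷ P) (true ∷ Q) v u (true ∷ B) h =
    between⇒within P Q v u B (between-tail true true true (+-comm 1 u) (+-comm 1 v) h)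

  -- The path tested is Q itself: it keeps v = 0, so u is the distance of P and Q, and `within`
  -- rejects any crossing.
  region : ∀ {n} w (P Q : Subset n) → within P Q 0 w Q ≡ true → Region w P Q
  region zero    []          []          _ = nil
  region (suc w) []          []          ()
  region w       (false ∷ P) (false ∷ Q) h = EE (region w P Q h)
  region w       (false ∷ P) (true ∷ Q)  h = EN (region (suc w) P Q h)
  region (suc w) (true ∷ P)  (false ∷ Q) h = NE (region w P Q h)
  region w       (true ∷ P)  (true ∷ Q)  h = NN (region w P Q h)

  allL⇒∀ : ∀ {X : Set} (p : X → Bool) {xs x} → allL p xs ≡ true → x ∈ xs → p x ≡ true
  allL⇒∀ p h (here refl)    = ∧-conicalˡ _ _ h
  allL⇒∀ p h (there x∈xs) = allL⇒∀ p (∧-conicalʳ (p _) _ h) x∈xs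

  ∀⇒allL : ∀ {X : Set} (p : X → Bool) xs → (∀ x → p x ≡ true) → allL p xs ≡ true
  ∀⇒allL p []       h = refl
  ∀⇒allL p (x ∷ xs) h = cong₂ _∧_ (h x) (∀⇒allL p xs h)

  pre-saturated : ∀ {n} (A : Subset n) {k} → n ≤ k → pre A k ≡ ∣ A ∣
  pre-saturated []          n≤k       = refl
  pre-saturated (true ∷ A)  (s≤s n≤k) = cong suc (pre-saturated A n≤k)
  pre-saturated (false ∷ A) (s≤s n≤k) = pre-saturated A n≤k

  module _ (L : LPMPres) where
    open LPMPres L

    lpm⇒between : ∀ B → lpm L B ≡ true → Between P Q 0 0 B
    lpm⇒between B h = between (λ k → proj₁ (bounds k)) (λ k → proj₂ (bounds k))
      (trans P-card (sym card)) (trans card (sym Q-card))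
      where
      card : ∣ B ∣ ≡ r
      card = ≡ᵇ⇒≡ ∣ B ∣ r (Equivalence.from T-≡ (∧-conicalˡ _ _ h))
      bounds : ∀ k → pre P k ≤ pre B k × pre B k ≤ pre Q k
      bounds k with k ≤? m + r
      ... | yes k≤n =
        ≤ᵇ⇒≤ (pre P k) (pre B k) (Equivalence.from T-≡ (∧-conicalˡ _ _ checks)) ,
        ≤ᵇ⇒≤ (pre B k) (pre Q k) (Equivalence.from T-≡ (∧-conicalʳ (pre P k ≤ᵇ pre B k) _ checks))
        where
        checks = allL⇒∀ (λ k → (pre P k ≤ᵇ pre B k) ∧ (pre B k ≤ᵇ pre Q k))
          (∧-conicalʳ (∣ B ∣ ≡ᵇ r) _ h) (∈-upTo⁺ (s≤s k≤n))
      -- `lpm` tests only k ≤ m + r; beyond that all prefix counts equal the common cardinality `r`.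
      ... | no k≰n with n≤k ← ≰⇒≥ k≰n
        rewrite pre-saturated P n≤k | pre-saturated B n≤k | pre-saturated Q n≤k | P-card | Q-card | card =
        ≤-refl , ≤-refl

    between⇒lpm : ∀ B → Between P Q 0 0 B → lpm L B ≡ true
    between⇒lpm B h = cong₂ _∧_
      (Equivalence.to T-≡ (≡⇒≡ᵇ ∣ B ∣ r (trans (endꟴ h) Q-card)))
      (∀⇒allL _ (upTo (suc (m + r))) λ k → cong₂ _∧_
        (Equivalence.to T-≡ (≤⇒≤ᵇ (above h k))) (Equivalence.to T-≡ (≤⇒≤ᵇ (below h k))))

    lpm≡within : ∀ B → lpm L B ≡ within P Q 0 0 B
    lpm≡within B = ⇔→≡ (mk⇔ (between⇒within P Q 0 0 B ∘ lpm⇒between B)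
                            (between⇒lpm B ∘ within⇒between P Q 0 0 B))

    lpm-region : Region 0 P Q
    lpm-region = region 0 P Q (between⇒within P Q 0 0 Q
      (between P≤Q (λ _ → ≤-refl) (trans P-card (sym Q-card)) refl))

  -- Invariance under isomorphism

  module _ {n n′} (σ : Fin n ↔ Fin n′) where
    open Inverse σ using (to; from; strictlyInverseˡ; strictlyInverseʳ)

    lookup-image : ∀ B i → lookup (image σ B) i ≡ lookup B (from i)
    lookup-image B = lookup∘tabulate (λ i → lookup B (from i))

    image-∩ : ∀ A B → image σ (A ∩ B) ≡ image σ A ∩ image σ B
    image-∩ A B = trans (tabulate-cong λ i → begin
      lookup (A ∩ B) (from i)                        ≡⟨ lookup-zipWith _∧_ (from i) A B ⟩
      lookup A (from i) ∧ lookup B (from i)          ≡⟨ cong₂ _∧_ (lookup-image A i) (lookup-image B i) ⟨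
      lookup (image σ A) i ∧ lookup (image σ B) i    ≡⟨ lookup-zipWith _∧_ i (image σ A) (image σ B) ⟨
      lookup (image σ A ∩ image σ B) i               ∎) (tabulate∘lookup _)
      where open ≡-Reasoning

    image-from : ∀ B → image σ (image (↔-sym σ) B) ≡ B
    image-from B = trans (tabulate-cong λ i →
      trans (lookup∘tabulate (λ j → lookup B (to j)) (from i)) (cong (lookup B) (strictlyInverseˡ i)))
      (tabulate∘lookup B)

    image-to : ∀ B → image (↔-sym σ) (image σ B) ≡ B
    image-to B = trans (tabulate-cong λ i →
      trans (lookup-image B (to i)) (cong (lookup B) (strictlyInverseʳ i)))
      (tabulate∘lookup B)

  card-sum : ∀ {n} (A : Subset n) → ∣ A ∣ ≡ sum (λ i → bit (lookup A i))
  card-sum []          = refl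
  card-sum (true ∷ A)  = cong suc (card-sum A)
  card-sum (false ∷ A) = card-sum A

  card-image : ∀ {n n′} (σ : Fin n ↔ Fin n′) A → ∣ image σ A ∣ ≡ ∣ A ∣
  card-image σ A = begin
    ∣ image σ A ∣                                    ≡⟨ card-sum (image σ A) ⟩
    sum (λ i → bit (lookup (image σ A) i))           ≡⟨ sum-cong-≗ (λ i → cong bit (lookup-image σ A i)) ⟩
    sum (λ i → bit (lookup A (Inverse.from σ i)))    ≡⟨ sum-permute (λ i → bit (lookup A i)) (↔-sym σ) ⟨
    sum (λ i → bit (lookup A i))                     ≡⟨ card-sum A ⟨
    ∣ A ∣                                            ∎
    where open ≡-Reasoning

  image-full : ∀ {n n′} (σ : Fin n ↔ Fin n′) → image σ (fullSet n) ≡ fullSet n′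
  image-full σ = tabulate-cong λ i → lookup∘tabulate (λ _ → true) (Inverse.from σ i)

  rank-image : ∀ {n n′} {M : BasisSystem n} {N : BasisSystem n′} ((σ , _) : M ≅ N) A →
    rank N (image σ A) ≡ rank M A
  rank-image {M = M} {N} (σ , iso) A = ≤-antisym
    (rank-least N (image σ A) λ B NB →
      let B′ = image (↔-sym σ) B in
      subst (_≤ rank M A) (trans (sym (card∩ B′)) (cong (λ X → ∣ image σ A ∩ X ∣) (image-from σ B)))
        (rank-upper M A (trans (iso B′) (trans (cong N (image-from σ B)) NB))))
    (rank-least M A λ B MB →
      subst (_≤ rank N (image σ A)) (card∩ B) (rank-upper N (image σ A) (trans (sym (iso B)) MB)))
    where
    card∩ : ∀ B → ∣ image σ A ∩ image σ B ∣ ≡ ∣ A ∩ B ∣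
    card∩ B = trans (cong ∣_∣ (sym (image-∩ σ A B))) (card-image σ (A ∩ B))

  Σ-↭ : ∀ {X : Set} (f : X → ℤ) {xs ys} → xs ↭ ys → Σ-of f xs ≡ Σ-of f ys
  Σ-↭ f ↭.refl         = refl
  Σ-↭ f (↭.prep x p)   = cong (λ s → f x ℤ.+ s) (Σ-↭ f p)
  Σ-↭ f (↭.swap {xs} {ys} x y p) = begin
    f x ℤ.+ (f y ℤ.+ Σ-of f xs)  ≡⟨ ℤ.+-assoc (f x) (f y) _ ⟨
    f x ℤ.+ f y ℤ.+ Σ-of f xs    ≡⟨ cong₂ ℤ._+_ (ℤ.+-comm (f x) (f y)) (Σ-↭ f p) ⟩
    f y ℤ.+ f x ℤ.+ Σ-of f ys    ≡⟨ ℤ.+-assoc (f y) (f x) _ ⟩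
    f y ℤ.+ (f x ℤ.+ Σ-of f ys)  ∎
    where open ≡-Reasoning
  Σ-↭ f (↭.trans p q)  = trans (Σ-↭ f p) (Σ-↭ f q)

  allSubsets-unique : ∀ n → Unique (allSubsets n)
  allSubsets-unique zero    = [] ∷ []
  allSubsets-unique (suc n) = ++⁺ (map⁺ ∷-injectiveʳ (allSubsets-unique n)) (map⁺ ∷-injectiveʳ (allSubsets-unique n))
    λ (p , q) → disjoint (∈-map⁻ (true ∷_) p) (∈-map⁻ (false ∷_) q)
    where
    disjoint : ∀ {A : Subset (suc n)} → (∃ λ B → B ∈ allSubsets n × A ≡ true ∷ B) →
      ¬ (∃ λ B → B ∈ allSubsets n × A ≡ false ∷ B)
    disjoint (_ , _ , refl) (_ , _ , ())

  -- Both lists are free of repetitions and contain every subset, so they are permutations of each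
  -- other.
  allSubsets-image : ∀ {n n′} (σ : Fin n ↔ Fin n′) → map (image σ) (allSubsets n) ↭ allSubsets n′
  allSubsets-image {n} {n′} σ = ∼bag⇒↭ (unique∧set⇒bag
    (map⁺ (λ {A} {B} eq → trans (sym (image-to σ A)) (trans (cong (image (↔-sym σ)) eq) (image-to σ B)))
      (allSubsets-unique n))
    (allSubsets-unique n′)
    λ {A} → mk⇔ (λ _ → ∈-allSubsets A)
      (λ _ → subst (_∈ map (image σ) (allSubsets n)) (image-from σ A)
               (∈-map⁺ (image σ) (∈-allSubsets (image (↔-sym σ) A)))))

  tutte-≅ : ∀ {n n′} {M : BasisSystem n} {N : BasisSystem n′} → M ≅ N → ∀ x y → tutte M x y ≡ tutte N x y
  tutte-≅ {n} {n′} {M} {N} iso@(σ , _) x y = begin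
    Σ-of (term M) (allSubsets n)                  ≡⟨ Σ-cong term-image (allSubsets n) ⟩
    Σ-of (λ A → term N (image σ A)) (allSubsets n) ≡⟨ cong (foldr ℤ._+_ (+ 0)) (map-∘ (allSubsets n)) ⟩
    Σ-of (term N) (map (image σ) (allSubsets n))  ≡⟨ Σ-↭ (term N) (allSubsets-image σ) ⟩
    Σ-of (term N) (allSubsets n′)                 ∎
    where
    open ≡-Reasoning
    term : ∀ {n} → BasisSystem n → Subset n → ℤ
    term {n} M A = ((x ℤ.- + 1) ℤ.^ (rank M (fullSet n) ∸ rank M A)) ℤ.* ((y ℤ.- + 1) ℤ.^ (∣ A ∣ ∸ rank M A))
    full : rank N (fullSet n′) ≡ rank M (fullSet n)
    full = trans (cong (rank N) (sym (image-full σ))) (rank-image {M = M} {N} iso (fullSet n))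
    term-image : ∀ A → term M A ≡ term N (image σ A)
    term-image A rewrite full | rank-image {M = M} {N} iso A | card-image σ A = refl

  -- Direct sums of trivial snakes

  half : ∀ {n k} {P Q : Subset n} → Snakes k P Q → Fin n → Fin k ⊎ Fin k
  half (snake s) zero          = inj₁ zero
  half (snake s) (suc zero)    = inj₂ zero
  half (snake s) (suc (suc i)) = Sum.map suc suc (half s i)

  unhalf : ∀ {n k} {P Q : Subset n} → Snakes k P Q → Fin k ⊎ Fin k → Fin n
  unhalf (snake s) (inj₁ zero)    = zero
  unhalf (snake s) (inj₂ zero)    = suc zero
  unhalf (snake s) (inj₁ (suc j)) = suc (suc (unhalf s (inj₁ j)))
  unhalf (snake s) (inj₂ (suc j)) = suc (suc (unhalf s (inj₂ j)))

  half-unhalf : ∀ {n k} {P Q : Subset n} (s : Snakes k P Q) j → half s (unhalf s j) ≡ j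
  half-unhalf (snake s) (inj₁ zero)    = refl
  half-unhalf (snake s) (inj₂ zero)    = refl
  half-unhalf (snake s) (inj₁ (suc j)) = cong (Sum.map suc suc) (half-unhalf s (inj₁ j))
  half-unhalf (snake s) (inj₂ (suc j)) = cong (Sum.map suc suc) (half-unhalf s (inj₂ j))

  unhalf-half : ∀ {n k} {P Q : Subset n} (s : Snakes k P Q) i → unhalf s (half s i) ≡ i
  unhalf-half (snake s) zero          = refl
  unhalf-half (snake s) (suc zero)    = refl
  unhalf-half (snake s) (suc (suc i)) with half s i | unhalf-half s i
  ... | inj₁ j | eq = cong (λ i → suc (suc i)) eq
  ... | inj₂ j | eq = cong (λ i → suc (suc i)) eq

  -- Parallel elements are adjacent along the paths, but lie k apart in `trivialSnakeSum k`.
  halves : ∀ {n k} {P Q : Subset n} → Snakes k P Q → Fin n ↔ Fin (k + k)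
  halves s = ↔-sym +↔⊎ ↔-∘ mk↔ₛ′ (half s) (unhalf s) (half-unhalf s) (unhalf-half s)

  within-∷-snake : ∀ {n} (P Q : Subset n) b b′ B →
    within (false ∷ true ∷ P) (true ∷ false ∷ Q) 0 0 (b ∷ b′ ∷ B) ≡ (b xor b′) ∧ within P Q 0 0 B
  within-∷-snake P Q true  true  B = refl
  within-∷-snake P Q true  false B = refl
  within-∷-snake P Q false true  B = refl
  within-∷-snake P Q false false B = refl

  -- The test `p` and the enumeration `f` are general because the tail of `allFin` is a `tabulate`
  -- of successors, not an `allFin`.
  within-snakes : ∀ {n k} {P Q : Subset n} (s : Snakes k P Q) B {X : Set} (p : X → Bool) (f : Fin k → X) →
    (∀ j → p (f j) ≡ lookup B (unhalf s (inj₁ j)) xor lookup B (unhalf s (inj₂ j))) →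
    within P Q 0 0 B ≡ allL p (List.tabulate f)
  within-snakes none [] p f h = refl
  within-snakes {P = _ ∷ _ ∷ P} {_ ∷ _ ∷ Q} (snake s) (b ∷ b′ ∷ B) p f h =
    trans (within-∷-snake P Q b b′ B)
      (cong₂ _∧_ (sym (h zero)) (within-snakes s B p (f ∘ suc) (h ∘ suc)))

  snakes⇒trivial : ∀ {n n′ k} {M : BasisSystem n} {P Q : Subset n′} (σ : Fin n ↔ Fin n′) →
    (∀ B → M B ≡ within P Q 0 0 (image σ B)) → Snakes k P Q → M ≅ trivialSnakeSum k
  snakes⇒trivial {k = k} {M} σ iso s = τ , λ B →
    trans (iso B) (within-snakes s (image σ B) _ (λ j → j) λ j → cong₂ _xor_
      (entry B (inj₁ j)) (entry B (inj₂ j)))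
    where
    τ = halves s ↔-∘ σ
    entry : ∀ B j → lookup (image τ B) (join k k j) ≡ lookup (image σ B) (unhalf s j)
    entry B j = begin
      lookup (image τ B) (join k k j)  ≡⟨ lookup-image τ B (join k k j) ⟩
      lookup B (Inverse.from σ (unhalf s (Inverse.to (+↔⊎ {k} {k}) (join k k j))))
        ≡⟨ cong (λ i → lookup B (Inverse.from σ (unhalf s i))) (Inverse.strictlyInverseˡ (+↔⊎ {k} {k}) j) ⟩
      lookup B (Inverse.from σ (unhalf s j)) ≡⟨ lookup-image σ B (unhalf s j) ⟨
      lookup (image σ B) (unhalf s j) ∎
      where open ≡-Reasoning

  module _ {n n′} (M : BasisSystem n) {P Q : Subset n′} (σ : Fin n ↔ Fin n′)
           (iso : ∀ B → M B ≡ within P Q 0 0 (image σ B)) where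

    attains-all : Loopless M → ColooplessM M → ∀ b e → Attains b 0 P Q e
    attains-all loopless coloopless b e =
      let B , MB , val = basis b in
      attains {v = 0} {0} {image σ B} refl (trans (sym (iso B)) MB) (trans (lookup-image σ B e) val)
      where
      basis : ∀ b → ∃ λ B → M B ≡ true × lookup B (Inverse.from σ e) ≡ b
      basis true  = loopless (Inverse.from σ e)
      basis false = coloopless (Inverse.from σ e)

    tutte≡T : Region 0 P Q → ∀ x y → tutte M (+ x) (+ y) ≡ + T x y P Q 0 0
    tutte≡T R x y = trans (tutte-≅ {N = within P Q 0 0} (σ , iso) (+ x) (+ y)) (tutte-within x y R 0 0 refl)

-- Passage to the integers

open LatticePaths
open import Data.Nat as ℕ using (ℕ)
open import Data.Integer using (_*_; _^_; _≤_)

theorem1p3 : {n : ℕ} (M : BasisSystem n) → IsLPM M → Loopless M → ColooplessM M →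
    ¬ IsoToTrivialSnakeSum M →
    + 4 * (tutte M (+ 1) (+ 1) ^ 2) ≤ + 3 * (tutte M (+ 2) (+ 0) * tutte M (+ 0) (+ 2))
theorem1p3 M (L , σ , iso) loopless coloopless nontrivial =
  conclude (invariant (lpm-region L) (attains-all M σ iso′ loopless coloopless))
  where
  open LPMPres L using (P; Q)

  iso′ : ∀ B → M B ≡ within P Q 0 0 (image σ B)
  iso′ B = trans (iso B) (lpm≡within L (image σ B))

  conclude : Closed P Q →
    + 4 * (tutte M (+ 1) (+ 1) ^ 2) ≤ + 3 * (tutte M (+ 2) (+ 0) * tutte M (+ 0) (+ 2))
  conclude (_ , inj₁ (k , s)) = contradiction (k , snakes⇒trivial σ iso′ s) nontrivial
  -- The power `^ 2` unfolds to a product ending in 1; after its removal all products are moved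
  -- inside `+_`.
  conclude (_ , inj₂ bound)
    rewrite tutte≡T M σ iso′ (lpm-region L) 1 1
          | tutte≡T M σ iso′ (lpm-region L) 2 0
          | tutte≡T M σ iso′ (lpm-region L) 0 2
          | ℤ.*-identityʳ (+ T₁₁ P Q)
          | sym (ℤ.pos-* (T₁₁ P Q) (T₁₁ P Q)) | sym (ℤ.pos-* 4 (T₁₁ P Q ℕ.* T₁₁ P Q))
          | sym (ℤ.pos-* (T₂₀ P Q) (T₀₂ P Q)) | sym (ℤ.pos-* 3 (T₂₀ P Q ℕ.* T₀₂ P Q)) =
    ℤ.+≤+ bound
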